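{- Fix an integer $r\ge 4$ and reals $P\ge 2$ and $C\ge 2$. There is a constant $K=K(r,P,C)$ such that for every integer $k\ge 2$, $$f_{P,C}(k,r)\le k^K.$$ In particular, $f_{P,C}(k,5)\le k^{O_{P,C}(1)}$.
   Context: All graphs are finite and simple; subgraphs need not be induced. $\chi$ is the chromatic number, $e(G)$ the number of edges; the girth of a forest is $\infty$. $h_r(G)=\max\{\chi(H):H\subseteq G,\ \operatorname{girth}(H)\ge r\}$. The sparse-regime threshold $f_{P,C}(k,r)$ is the least $M$ such that every graph $G$ with $e(G)\le C\chi(G)^P$ and $\chi(G)\ge M$ satisfies $h_r(G)\ge k$. -}

module Defs where

open import Data.Bool using (Bool; true; false; T; T?)
open import Data.Empty using (⊥; ⊥-elim)
open import Data.Fin as Fin using (Fin; toℕ; fromℕ<)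
open import Data.Fin.Properties as Fin using (any?; all?)
open import Data.Integer using (+_)
open import Data.List using (length; filter; cartesianProduct; allFin)
open import Data.Nat
open import Data.Nat.Properties
open import Data.Product using (∃; ∃-syntax; _×_; _,_; proj₁; proj₂)
open import Data.Rational as ℚ using (ℚ)
open import Data.Sum using (_⊎_; inj₁; inj₂)
open import Function using (_∘_; id)
open import Function.Bundles using (_⇔_; mk⇔)
open import Function.Definitions using (Injective)
open import Level using (Level; 0ℓ)
open import Relation.Binary.Construct.Add.Supremum.NonStrict _≤_ using (_≤⁺_; _≤⊤⁺; [_]; ≤⁺-dec)
open import Relation.Binary.PropositionalEquality using (_≡_; refl; sym; trans; cong; subst)
open import Relation.Nullary using (¬_; Dec; yes; no)
open import Relation.Nullary.Construct.Add.Supremum using (_⁺; ⊤⁺; [_])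
open import Relation.Nullary.Decidable using (map′; _×-dec_; _→-dec_; ¬?; decidable-stable)
open import Relation.Unary using (Pred; Decidable)

------------------------------------------------------------------------
-- Minima and maxima of sets of natural numbers

IsLeast : ∀ {ℓ} → Pred ℕ ℓ → Pred ℕ ℓ
IsLeast S m = S m × (∀ n → S n → m ≤ n)

IsGreatest : ∀ {ℓ} → Pred ℕ ℓ → Pred ℕ ℓ
IsGreatest S m = S m × (∀ n → S n → n ≤ m)

private variable
  ℓ : Level

least? : {S : Pred ℕ ℓ} → Decidable S → ∀ b →
         ∃ (IsLeast S) ⊎ (∀ n → n < b → ¬ S n)
least? S? zero = inj₂ λ _ ()
least? S? (suc b) with least? S? b
... | inj₁ least = inj₁ least
... | inj₂ none with S? b
...   | yes Sb = inj₁ (b , Sb , λ n Sn → ≮⇒≥ (λ n<b → none n n<b Sn))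
...   | no ¬Sb = inj₂ λ n n<1+b Sn → none n
                   (≤∧≢⇒< (s≤s⁻¹ n<1+b) λ { refl → ¬Sb Sn }) Sn

least : {S : Pred ℕ ℓ} → Decidable S → ∃ S → ∃ (IsLeast S)
least S? (b , Sb) with least? S? (suc b)
... | inj₁ m = m
... | inj₂ none = ⊥-elim (none b ≤-refl Sb)

greatest : {S : Pred ℕ ℓ} → Decidable S → ∀ b → (∀ n → S n → n ≤ b) →
           ∃ S → ∃ (IsGreatest S)
greatest {S = S} S? zero bound (n , Sn) =
  zero , subst S (n≤0⇒n≡0 (bound n Sn)) Sn , bound
greatest S? (suc b) bound ∃S with S? (suc b)
... | yes S1+b = suc b , S1+b , bound
... | no ¬S1+b = greatest S? b bound′ ∃S
  where
  bound′ : ∀ n → _ → n ≤ b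
  bound′ n Sn = s≤s⁻¹ (≤∧≢⇒< (bound n Sn) λ { refl → ¬S1+b Sn })

IsLeast-unique : {S S′ : Pred ℕ ℓ} → (∀ {n} → S n → S′ n) → (∀ {n} → S′ n → S n) →
                 ∀ {m m′} → IsLeast S m → IsLeast S′ m′ → m ≡ m′
IsLeast-unique to from (Sm , min) (S′m′ , min′) =
  ≤-antisym (min _ (from S′m′)) (min′ _ (to Sm))

------------------------------------------------------------------------
-- Exhaustive search, for predicates respecting a given relation

Searchable : (A : Set) → (A → A → Set) → Set₁
Searchable A _~_ =
  {Q : A → Set} → (∀ {x y} → x ~ y → Q x → Q y) → Decidable Q → Dec (∃ Q)

search-Bool : Searchable Bool _≡_
search-Bool _ Q? with Q? true | Q? false
... | yes q | _     = yes (true , q)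
... | no _  | yes q = yes (false , q)
... | no ¬t | no ¬f = no λ { (true , q) → ¬t q ; (false , q) → ¬f q }

search-Fin : ∀ {n} → Searchable (Fin n) _≡_
search-Fin _ = any?

search-Π : ∀ {A _~_} → (∀ {x} → x ~ x) → Searchable A _~_ →
           ∀ {n} → Searchable (Fin n → A) (λ f g → ∀ i → f i ~ g i)
search-Π {A} ~-refl search {zero} resp Q? =
  map′ (empty ,_) (λ (f , q) → resp {f} {empty} (λ ()) q) (Q? empty)
  where
  empty : Fin 0 → A
  empty ()
search-Π {A} {_~_} ~-refl search {suc n} {Q} resp Q? =
  map′ (λ (x , f , q) → cons x f , q)
       (λ (f , q) → f Fin.zero , f ∘ Fin.suc ,
                    resp {f} {cons (f Fin.zero) (f ∘ Fin.suc)}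
                      (λ { Fin.zero → ~-refl ; (Fin.suc i) → ~-refl }) q)
       (search respHead λ x → search-Π ~-refl search (respTail x) (λ f → Q? (cons x f)))
  where
  cons : A → (Fin n → A) → Fin (suc n) → A
  cons x f Fin.zero    = x
  cons x f (Fin.suc i) = f i

  respTail : ∀ x {f g} → (∀ i → f i ~ g i) → Q (cons x f) → Q (cons x g)
  respTail x {f} {g} f~g = resp {cons x f} {cons x g}
    λ { Fin.zero → ~-refl ; (Fin.suc i) → f~g i }

  respHead : ∀ {x y} → x ~ y → (∃ λ f → Q (cons x f)) → ∃ λ f → Q (cons y f)
  respHead {x} {y} x~y (f , q) = f , resp {cons x f} {cons y f}
    (λ { Fin.zero → x~y ; (Fin.suc i) → ~-refl }) q

------------------------------------------------------------------------
-- Finite simple graphs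

record Graph : Set where
  field
    order  : ℕ
    adj    : Fin order → Fin order → Bool

  Vertex : Set
  Vertex = Fin order

  Adj : Vertex → Vertex → Set
  Adj u v = T (adj u v)

  field
    symmetric   : ∀ u v → Adj u v → Adj v u
    irreflexive : ∀ v → ¬ Adj v v

open Graph public using (order; Vertex; Adj)

Adj? : ∀ G (u v : Vertex G) → Dec (Adj G u v)
Adj? G u v = T? (Graph.adj G u v)

-- Each edge is counted once, as a pair u < v.
IsEdge : ∀ G → Pred (Vertex G × Vertex G) 0ℓ
IsEdge G (u , v) = u Fin.< v × Adj G u v

IsEdge? : ∀ G → Decidable (IsEdge G)
IsEdge? G (u , v) = u Fin.<? v ×-dec Adj? G u v

e : Graph → ℕ
e G = length (filter (IsEdge? G) (cartesianProduct (allFin (order G)) (allFin (order G))))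

-- Subgraphs (not necessarily induced or spanning) are considered up to
-- isomorphism: H ⊆ G says that H is isomorphic to a subgraph of G.
infix 4 _⊆_

_⊆_ : Graph → Graph → Set
H ⊆ G = ∃ λ (φ : Vertex H → Vertex G) →
  Injective _≡_ _≡_ φ × (∀ u v → Adj H u v → Adj G (φ u) (φ v))

private
  injective? : ∀ {m n} (f : Fin m → Fin n) → Dec (Injective _≡_ _≡_ f)
  injective? f = map′ (λ inj {i} {j} → inj i j) (λ inj i j → inj)
    (all? λ i → all? λ j → (f i Fin.≟ f j) →-dec (i Fin.≟ j))

  injective-resp : ∀ {m n} {f g : Fin m → Fin n} → (∀ i → f i ≡ g i) →
                   Injective _≡_ _≡_ f → Injective _≡_ _≡_ g
  injective-resp f≗g inj {i} {j} eq = inj (trans (f≗g i) (trans eq (sym (f≗g j))))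

  Adj-resp : ∀ G {u u′ v v′} → u ≡ u′ → v ≡ v′ → Adj G u v → Adj G u′ v′
  Adj-resp G refl refl = id

⊆-dec : ∀ H G → Dec (H ⊆ G)
⊆-dec H G = search-Π refl search-Fin
  (λ f≗g (inj , hom) → injective-resp f≗g inj ,
    λ u v uv → Adj-resp G (f≗g u) (f≗g v) (hom u v uv))
  (λ f → injective? f ×-dec
    all? λ u → all? λ v → Adj? H u v →-dec Adj? G (f u) (f v))

------------------------------------------------------------------------
-- Chromatic number

Proper : (G : Graph) {c : ℕ} → (Vertex G → Fin c) → Set
Proper G f = ∀ u v → Adj G u v → ¬ f u ≡ f v

Colorable : Graph → ℕ → Set
Colorable G c = ∃ λ (f : Vertex G → Fin c) → Proper G f

Colorable? : ∀ G → Decidable (Colorable G)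
Colorable? G c = search-Π refl search-Fin
  (λ f≗g proper u v uv eq → proper u v uv (trans (f≗g u) (trans eq (sym (f≗g v)))))
  (λ f → all? λ u → all? λ v → Adj? G u v →-dec ¬? (f u Fin.≟ f v))

order-colorable : ∀ G → Colorable G (order G)
order-colorable G = id , λ { u .u uu refl → Graph.irreflexive G u uu }

private abstract
  chromatic : ∀ G → ∃ (IsLeast (Colorable G))
  chromatic G = least (Colorable? G) (order G , order-colorable G)

χ : Graph → ℕ
χ G = proj₁ (chromatic G)

χ-isLeast : ∀ G → IsLeast (Colorable G) (χ G)
χ-isLeast G = proj₂ (chromatic G)

------------------------------------------------------------------------
-- Girth

-- v₀, …, v_{ℓ-1} are distinct, consecutive ones are adjacent, and the last
-- is adjacent to the first.
IsCycle : (G : Graph) {ℓ : ℕ} → (Fin ℓ → Vertex G) → Set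
IsCycle G {ℓ} v =
    Injective _≡_ _≡_ v
  × (∀ i j → toℕ j ≡ suc (toℕ i) → Adj G (v i) (v j))
  × (∀ i j → suc (toℕ i) ≡ ℓ → toℕ j ≡ 0 → Adj G (v i) (v j))

HasCycle : Graph → ℕ → Set
HasCycle G ℓ = 3 ≤ ℓ × ∃ λ (v : Fin ℓ → Vertex G) → IsCycle G v

HasCycle? : ∀ G → Decidable (HasCycle G)
HasCycle? G ℓ = 3 ≤? ℓ ×-dec search-Π refl search-Fin
  (λ f≗g (inj , step , close) → injective-resp f≗g inj ,
    (λ i j p → Adj-resp G (f≗g i) (f≗g j) (step i j p)) ,
    (λ i j p q → Adj-resp G (f≗g i) (f≗g j) (close i j p q)))
  (λ v → injective? v
    ×-dec (all? λ i → all? λ j → (toℕ j ≟ suc (toℕ i)) →-dec Adj? G (v i) (v j))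
    ×-dec (all? λ i → all? λ j → (suc (toℕ i) ≟ ℓ) →-dec (toℕ j ≟ 0) →-dec Adj? G (v i) (v j)))

IsGirth : Graph → ℕ ⁺ → Set
IsGirth G [ g ] = IsLeast (HasCycle G) g
IsGirth G ⊤⁺    = ∀ ℓ → ¬ HasCycle G ℓ

private abstract
  girth-of : ∀ G → ∃ (IsGirth G)
  girth-of G with least? (HasCycle? G) (suc (order G))
  ... | inj₁ (g , isLeast) = [ g ] , isLeast
  ... | inj₂ none = ⊤⁺ , λ ℓ cyc@(_ , _ , inj , _) →
                      none ℓ (s≤s (Fin.injective⇒≤ inj)) cyc

girth : Graph → ℕ ⁺
girth G = proj₁ (girth-of G)

girth-isGirth : ∀ G → IsGirth G (girth G)
girth-isGirth G = proj₂ (girth-of G)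

------------------------------------------------------------------------
-- The invariant h_r

LargeGirthChromatic : ℕ → Graph → ℕ → Set
LargeGirthChromatic r G c = ∃[ H ] H ⊆ G × [ r ] ≤⁺ girth H × χ H ≡ c

private
  mkGraph : ∀ n (a : Fin n → Fin n → Bool) →
            (∀ u v → T (a u v) → T (a v u)) → (∀ v → ¬ T (a v v)) → Graph
  mkGraph n a s i = record { order = n ; adj = a ; symmetric = s ; irreflexive = i }

  module _ {n : ℕ} {a b : Fin n → Fin n → Bool}
           {sa : ∀ u v → T (a u v) → T (a v u)} {ia : ∀ v → ¬ T (a v v)}
           {sb : ∀ u v → T (b u v) → T (b v u)} {ib : ∀ v → ¬ T (b v v)}
           (a≗b : ∀ u v → a u v ≡ b u v) where
    private
      A = mkGraph n a sa ia
      B = mkGraph n b sb ib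

      to : ∀ {u v} → Adj A u v → Adj B u v
      to = subst T (a≗b _ _)

      from : ∀ {u v} → Adj B u v → Adj A u v
      from = subst T (sym (a≗b _ _))

      cycle-to : ∀ {ℓ} → HasCycle A ℓ → HasCycle B ℓ
      cycle-to (l , v , inj , step , close) =
        l , v , inj , (λ i j p → to (step i j p)) , (λ i j p q → to (close i j p q))

      cycle-from : ∀ {ℓ} → HasCycle B ℓ → HasCycle A ℓ
      cycle-from (l , v , inj , step , close) =
        l , v , inj , (λ i j p → from (step i j p)) , (λ i j p q → from (close i j p q))

    χ-cong : χ A ≡ χ B
    χ-cong = IsLeast-unique
      (λ (f , p) → f , λ u v uv → p u v (from uv))
      (λ (f , p) → f , λ u v uv → p u v (to uv))
      (χ-isLeast A) (χ-isLeast B)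

    girth-cong : girth A ≡ girth B
    girth-cong with girth A | girth B | girth-isGirth A | girth-isGirth B
    ... | [ g ] | [ g′ ] | l | l′ = cong [_] (IsLeast-unique cycle-to cycle-from l l′)
    ... | [ g ] | ⊤⁺ | (cyc , _) | none = ⊥-elim (none g (cycle-to cyc))
    ... | ⊤⁺ | [ g ] | none | (cyc , _) = ⊥-elim (none g (cycle-from cyc))
    ... | ⊤⁺ | ⊤⁺ | _ | _ = refl

    ⊆-cong : ∀ {G} → A ⊆ G → B ⊆ G
    ⊆-cong (φ , inj , hom) = φ , inj , λ u v uv → hom u v (from uv)

LargeGirthChromatic? : ∀ r G → Decidable (LargeGirthChromatic r G)
LargeGirthChromatic? r G c = map′
  (λ (m , a , s , i , q) → mkGraph (toℕ m) a s i , q)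
  (λ (H , q@((_ , inj , _) , _)) → fromOrder H (s≤s (Fin.injective⇒≤ inj)) q)
  (any? λ m → search-Π (λ _ → refl) (search-Π refl search-Bool) resp dec)
  where
  Good : Graph → Set
  Good H = H ⊆ G × [ r ] ≤⁺ girth H × χ H ≡ c

  GoodAdj : ∀ n → (Fin n → Fin n → Bool) → Set
  GoodAdj n a = ∃ λ s → ∃ λ i → Good (mkGraph n a s i)

  transport : ∀ {n a b sa ia sb ib} → (∀ u v → a u v ≡ b u v) →
              Good (mkGraph n a sa ia) → Good (mkGraph n b sb ib)
  transport {sa = sa} {ia} {sb} {ib} a≗b (sub , gir , chr) =
    ⊆-cong {sa = sa} {ia} {sb} {ib} a≗b {G} sub ,
    subst ([ r ] ≤⁺_) (girth-cong a≗b) gir ,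
    trans (sym (χ-cong a≗b)) chr

  resp : ∀ {n} {a b : Fin n → Fin n → Bool} → (∀ u v → a u v ≡ b u v) →
         GoodAdj n a → GoodAdj n b
  resp a≗b (s , i , q) =
    (λ u v uv → subst T (a≗b v u) (s u v (subst T (sym (a≗b u v)) uv))) ,
    (λ v vv → i v (subst T (sym (a≗b v v)) vv)) ,
    transport a≗b q

  dec : ∀ {n} → Decidable (GoodAdj n)
  dec {n} a
    with all? (λ u → all? λ v → T? (a u v) →-dec T? (a v u)) | all? (λ v → ¬? (T? (a v v)))
  ... | no ¬s | _     = no λ (s , _) → ¬s s
  ... | yes _ | no ¬i = no λ (_ , i , _) → ¬i i
  ... | yes s | yes i = map′ (λ q → s , i , q) (λ (_ , _ , q) → transport (λ _ _ → refl) q)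
        (⊆-dec H G ×-dec ≤⁺-dec _≤?_ [ r ] (girth H) ×-dec χ H ≟ c)
    where H = mkGraph n a s i

  fromOrder : ∀ H → order H < suc (order G) → Good H →
              ∃ λ (m : Fin (suc (order G))) → ∃ (GoodAdj (toℕ m))
  fromOrder H lt q = fromℕ< lt ,
    subst (λ n → ∃ (GoodAdj n)) (sym (Fin.toℕ-fromℕ< lt))
      (Graph.adj H , Graph.symmetric H , Graph.irreflexive H , q)

private
  ∅ : Graph
  ∅ = mkGraph 0 (λ ()) (λ ()) (λ ())

  ∅-acyclic : ∀ r → [ r ] ≤⁺ girth ∅
  ∅-acyclic r with girth ∅ | girth-isGirth ∅
  ... | ⊤⁺        | _ = _ ≤⊤⁺
  ... | [ zero ]  | (() , _) , _
  ... | [ suc _ ] | (_ , v , _) , _ with () ← v Fin.zero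

  ∅-large : ∀ r G → LargeGirthChromatic r G (χ ∅)
  ∅-large r G = ∅ , ((λ ()) , (λ { {()} }) , λ ()) , ∅-acyclic r , refl

  large-bound : ∀ r G c → LargeGirthChromatic r G c → c ≤ order G
  large-bound r G c (H , (_ , inj , _) , _ , refl) =
    ≤-trans (proj₂ (χ-isLeast H) _ (order-colorable H)) (Fin.injective⇒≤ inj)

private abstract
  h-of : ∀ r G → ∃ (IsGreatest (LargeGirthChromatic r G))
  h-of r G = greatest (LargeGirthChromatic? r G) (order G) (large-bound r G)
                      (χ ∅ , ∅-large r G)

h : ℕ → Graph → ℕ
h r G = proj₁ (h-of r G)

h-isGreatest : ∀ r G → IsGreatest (LargeGirthChromatic r G) (h r G)
h-isGreatest r G = proj₂ (h-of r G)

------------------------------------------------------------------------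
-- Real numbers, as two-sided Dedekind cuts

record ℝ : Set₁ where
  field
    -- Lower q means q < x, and Upper q means x < q.
    Lower Upper     : ℚ → Set
    lower-inhabited : ∃ Lower
    upper-inhabited : ∃ Upper
    lower-closed    : ∀ {p q} → p ℚ.< q → Lower q → Lower p
    upper-closed    : ∀ {p q} → p ℚ.< q → Upper p → Upper q
    lower-open      : ∀ {p} → Lower p → ∃[ q ] p ℚ.< q × Lower q
    upper-open      : ∀ {q} → Upper q → ∃[ p ] p ℚ.< q × Upper p
    disjoint        : ∀ {q} → Lower q → ¬ Upper q
    located         : ∀ {p q} → p ℚ.< q → Lower p ⊎ Upper q

infix 4 _<ℚ_ _ℚ≤_

_<ℚ_ : ℝ → ℚ → Set
x <ℚ q = ℝ.Upper x q

_ℚ≤_ : ℚ → ℝ → Set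
q ℚ≤ x = ¬ (x <ℚ q)

-- m ≤ C · n ^ P, for real C, P > 0.  The right-hand side is the infimum of
-- (u / v) · n ^ (a / b) over the rationals u / v > C and a / b > P, and
-- m ≤ (u / v) · n ^ (a / b) is cleared of denominators and roots.
infix 4 _≤_·_^ᴿ_

_≤_·_^ᴿ_ : ℕ → ℝ → ℕ → ℝ → Set
m ≤ C · n ^ᴿ P = ∀ (u v a b : ℕ) .{{_ : NonZero v}} .{{_ : NonZero b}} →
  C <ℚ (+ u) ℚ./ v → P <ℚ (+ a) ℚ./ b → (m * v) ^ b ≤ u ^ b * n ^ a

------------------------------------------------------------------------
-- The sparse-regime threshold

Forces : (P C : ℝ) (k r : ℕ) → ℕ → Set
Forces P C k r M = ∀ G → e G ≤ C · χ G ^ᴿ P → M ≤ χ G → k ≤ h r G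

-- f_{P,C}(k,r) = M
IsThreshold : (P C : ℝ) (k r : ℕ) → ℕ → Set
IsThreshold P C k r = IsLeast (Forces P C k r)

-- f_{P,C}(k,r) ≤ N.  Forces quantifies over all graphs and is undecidable, so
-- even when some M is forcing, constructively the least one exists only up to
-- double negation.  By threshold≤⇔forces below no content is lost.
Threshold≤ : (P C : ℝ) (k r : ℕ) → ℕ → Set
Threshold≤ P C k r N = ¬ ¬ (∃[ M ] IsThreshold P C k r M × M ≤ N)

private
  ¬¬least : {S : Pred ℕ 0ℓ} → ∀ N → S N → ¬ ¬ (∃[ M ] IsLeast S M × M ≤ N)
  ¬¬least {S} N SN none = noneBelow (suc N) N ≤-refl SN
    where
    noneBelow : ∀ b n → n < b → ¬ S n
    noneBelow (suc b) n n<1+b Sn = none′ (n ≤? N)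
      where
      isLeast : IsLeast S n
      isLeast = Sn , λ m Sm → ≮⇒≥ λ m<n →
        noneBelow b m (<-≤-trans m<n (s≤s⁻¹ n<1+b)) Sm

      none′ : Dec (n ≤ N) → ⊥
      none′ (yes n≤N) = none (n , isLeast , n≤N)
      none′ (no n≰N)  = n≰N (proj₂ isLeast N SN)

threshold≤⇔forces : ∀ P C k r N → Threshold≤ P C k r N ⇔ Forces P C k r N
threshold≤⇔forces P C k r N = mk⇔
  (λ t G sparse N≤χ → decidable-stable (k ≤? h r G) λ k≰h →
    t λ (M , (forces , _) , M≤N) → k≰h (forces G sparse (≤-trans M≤N N≤χ)))
  (¬¬least N)

{-# OPTIONS --safe #-}
module Submission where

open import Defs
open import Algebra.Properties.CommutativeSemigroup using (x∙yz≈y∙xz; interchange)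
open import Data.Bool using (true; false)
open import Data.Fin as Fin using (Fin; combine; toℕ; _↑ˡ_; _↑ʳ_)
import Data.Fin.Properties as Fin
import Data.Integer as ℤ
open import Data.Integer using (+_; ∣_∣; -[1+_])
import Data.Integer.Properties as ℤ
open import Data.List using (List; []; _∷_; _++_; length; filter; map; concatMap; deduplicate; allFin; cartesianProduct; cartesianProductWith; lookup)
open import Data.List.Membership.Propositional using (_∈_; _∉_; lose; find)
open import Data.List.Membership.Propositional.Properties
open import Data.List.Properties using (length-++; length-map; length-filter; length-tabulate; length-deduplicate; filter-none)
open import Data.List.Relation.Unary.All as All using ([]; _∷_)
open import Data.List.Relation.Unary.Any as Any using (here; there)
open import Data.List.Relation.Unary.Any.Properties using (lookup-index)
open import Data.List.Relation.Unary.Unique.DecPropositional.Properties using (deduplicate-!)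
open import Data.List.Relation.Unary.Unique.Propositional using (Unique; []; _∷_)
import Data.List.Relation.Unary.Unique.Propositional.Properties as Unique
open import Data.Nat hiding (_/_)
import Data.Nat.Coprimality as Coprime
open import Data.Nat.DivMod using (_mod_; %-distribˡ-+; m%n%n≡m%n; m<n⇒m%n≡m; [m+n]%n≡m%n; m≤n⇒[n∸m]%m≡n%m; n%n≡0)
open import Data.Nat.ListAction using (sum)
open import Data.Nat.Properties
open import Data.Nat.Tactic.RingSolver using (solve-∀)
open import Data.Product using (∃; ∃-syntax; _×_; _,_; proj₁; proj₂)
open import Data.Product.Properties using (≡-dec)
open import Data.Rational as ℚ using (mkℚ; *<*; _/_)
import Data.Rational.Properties as ℚ
open import Data.Sum using (_⊎_; inj₁; inj₂)
open import Function using (_∘_; id)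
open import Function.Bundles using (Equivalence)
open import Function.Definitions using (Injective)
open import Relation.Binary.Construct.Add.Supremum.NonStrict _≤_ using (_≤⁺_; _≤⊤⁺; [_])
open import Relation.Binary.Definitions using (tri<; tri≈; tri>)
open import Relation.Binary.PropositionalEquality
open import Relation.Nullary using (¬_; Dec; yes; no; does; contradiction)
open import Relation.Nullary.Construct.Add.Supremum using (⊤⁺; [_])
open import Relation.Nullary.Decidable using (¬?; decidable-stable; _×-dec_; _⊎-dec_; isYes; toWitness; fromWitness)
open import Relation.Unary using (Decidable)

-- Writing n = χ(G), we may assume k^K ≤ n < (k+1)^K after increasing k, so that
-- e(G) is bounded by a power of k.  Build a subgraph H edge by edge, keeping its
-- maximum degree bounded and adding an edge uv of G only if v is far from u in H
-- (so no short cycle appears) and if u and v get the same colour in at least a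
-- 1/q fraction of the k-colourings still proper for H.  Each step kills this
-- fraction of the colourings, so there are at most O(q k |V|) steps.  If all
-- colourings die, H is the required subgraph.  Otherwise the process is stuck.
-- Random surviving colourings f₁, …, f_m have, since 2 e(G) < q^m, a common
-- refinement separating every edge on which fewer than a 1/q fraction of the
-- colourings agree; the edges left within its k^m classes join vertices that are
-- close in H or have a saturated end.  Hence the unsaturated vertices can be
-- coloured with few colours, and one restarts from the saturated ones, whose
-- number has dropped by a factor k.  This can be repeated only boundedly many
-- times, and all the colours lost along the way are fewer than n.

-- Counting, double counting and averaging.

private variable
  A B : Set

count : {P : A → Set} → Decidable P → List A → ℕ
count P? xs = length (filter P? xs)

sum-*-≤ : ∀ (f : A → ℕ) q d xs → (∀ {x} → x ∈ xs → f x * q ≤ d) →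
          sum (map f xs) * q ≤ length xs * d
sum-*-≤ f q d [] _ = z≤n
sum-*-≤ f q d (x ∷ xs) bound = begin
  (f x + sum (map f xs)) * q     ≡⟨ *-distribʳ-+ q (f x) _ ⟩
  f x * q + sum (map f xs) * q   ≤⟨ +-mono-≤ (bound (here refl)) (sum-*-≤ f q d xs (bound ∘ there)) ⟩
  d + length xs * d              ∎
  where open ≤-Reasoning

sum-*-≥ : ∀ (f : A → ℕ) q d xs → (∀ {x} → x ∈ xs → d ≤ f x * q) →
          length xs * d ≤ sum (map f xs) * q
sum-*-≥ f q d [] _ = z≤n
sum-*-≥ f q d (x ∷ xs) bound = begin
  d + length xs * d              ≤⟨ +-mono-≤ (bound (here refl)) (sum-*-≥ f q d xs (bound ∘ there)) ⟩
  f x * q + sum (map f xs) * q   ≡⟨ *-distribʳ-+ q (f x) _ ⟨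
  (f x + sum (map f xs)) * q     ∎
  where open ≤-Reasoning

module _ {R : A → B → Set} (R? : ∀ a b → Dec (R a b)) where

  private
    sum-count-∷ : ∀ a as bs →
      sum (map (λ b → count (λ x → R? x b) (a ∷ as)) bs) ≡
      count (R? a) bs + sum (map (λ b → count (λ x → R? x b) as) bs)
    sum-count-∷ a as [] = refl
    sum-count-∷ a as (b ∷ bs) with ih ← sum-count-∷ a as bs | does (R? a b)
    ... | true = cong suc (trans (cong (λ s → count (λ x → R? x b) as + s) ih)
      (x∙yz≈y∙xz +-commutativeSemigroup (count (λ x → R? x b) as) (count (R? a) bs) _))
    ... | false = trans (cong (λ s → count (λ x → R? x b) as + s) ih)
      (x∙yz≈y∙xz +-commutativeSemigroup (count (λ x → R? x b) as) (count (R? a) bs) _)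

  double-count : ∀ as bs →
    sum (map (λ a → count (R? a) bs) as) ≡ sum (map (λ b → count (λ a → R? a b) as) bs)
  double-count [] bs = sym (zeros bs)
    where
    zeros : ∀ (bs : List B) → sum (map (λ _ → 0) bs) ≡ 0
    zeros [] = refl
    zeros (_ ∷ bs) = zeros bs
  double-count (a ∷ as) bs =
    trans (cong (λ s → count (R? a) bs + s) (double-count as bs)) (sym (sum-count-∷ a as bs))

  -- If every `a` failed, summing over `as` would make `q` times the number of related pairs exceed
  -- `length as * length bs`, while summing over `bs` bounds it by that product.
  averaging : ∀ q as bs → 0 < length as →
              (∀ {b} → b ∈ bs → count (λ a → R? a b) as * q ≤ length as) →
              ∃[ a ] count (R? a) bs * q ≤ length bs
  averaging q as bs nonempty rare
    with Any.any? (λ a → count (R? a) bs * q ≤? length bs) as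
  ... | yes some = let a , _ , p = find some in a , p
  ... | no none = contradiction (begin
    length as * suc (length bs)                        ≤⟨ sum-*-≥ _ q _ as (λ a∈as → ≰⇒> (none ∘ lose a∈as)) ⟩
    sum (map (λ a → count (R? a) bs) as) * q           ≡⟨ cong (_* q) (double-count as bs) ⟩
    sum (map (λ b → count (λ a → R? a b) as) bs) * q   ≤⟨ sum-*-≤ _ q _ bs rare ⟩
    length bs * length as                              ≡⟨ *-comm (length bs) _ ⟩
    length as * length bs                              ∎)
    (<⇒≱ (*-monoʳ-< (length as) {{>-nonZero nonempty}} (n<1+n (length bs))))
    where open ≤-Reasoning

count-complement : {P : A → Set} (P? : Decidable P) (xs : List A) →
                   count (¬? ∘ P?) xs + count P? xs ≡ length xs
count-complement P? [] = refl
count-complement P? (x ∷ xs) with ih ← count-complement P? xs | does (P? x)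
... | true  = trans (+-suc _ _) (cong suc ih)
... | false = cong suc ih

-- Avoiding a short list, and greedy colouring.

∃∉ : ∀ {n} (xs : List (Fin n)) → length xs < n → ∃[ i ] i ∉ xs
∃∉ {n} xs short with Fin.any? (λ i → ¬? (Any.any? (i Fin.≟_) xs))
... | yes (i , i∉xs) = i , i∉xs
... | no none = contradiction (Fin.injective⇒≤ index-injective) (<⇒≱ short)
  where
  everywhere : ∀ i → i ∈ xs
  everywhere i = decidable-stable (Any.any? (i Fin.≟_) xs) λ i∉xs → none (i , i∉xs)

  index-injective : ∀ {i j} → Any.index (everywhere i) ≡ Any.index (everywhere j) → i ≡ j
  index-injective {i} {j} eq = trans (lookup-index (everywhere i))
    (trans (cong (lookup xs) eq) (sym (lookup-index (everywhere j))))

module _ {n : ℕ} where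

  update : {C : Set} → (Fin n → C) → Fin n → C → Fin n → C
  update f w c v with v Fin.≟ w
  ... | yes _ = c
  ... | no _  = f v

  update-≡ : {C : Set} (f : Fin n → C) (w : Fin n) (c : C) → update f w c w ≡ c
  update-≡ f w c with w Fin.≟ w
  ... | yes _ = refl
  ... | no w≢w = contradiction refl w≢w

  update-≢ : {C : Set} (f : Fin n → C) {w v : Fin n} (c : C) → v ≢ w → update f w c v ≡ f v
  update-≢ f {w} {v} c v≢w with v Fin.≟ w
  ... | yes v≡w = contradiction v≡w v≢w
  ... | no _ = refl

  -- `near` need not be symmetric: each vertex, when coloured, avoids the colours of its own list,
  -- so of two vertices near each other the one coloured later differs from the other.
  greedy-coloring : ∀ {B} (near : Fin n → List (Fin n)) → (∀ v → length (near v) < B) →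
    ∀ xs → ∃ λ (f : Fin n → Fin B) →
      ∀ {u v} → u ∈ xs → v ∈ xs → u ≢ v → u ∈ near v → v ∈ near u → f u ≢ f v
  -- `small v` makes `B` positive, so a default colour exists.
  greedy-coloring near small [] = (λ v → proj₁ (∃∉ [] (≤-<-trans z≤n (small v)))) , λ ()
  greedy-coloring {B} near small (x ∷ xs) with greedy-coloring near small xs
  ... | f , proper = g , g-proper
    where
    fresh : ∃[ c ] c ∉ map f (near x)
    fresh = ∃∉ (map f (near x)) (subst (_< B) (sym (length-map f (near x))) (small x))

    g : Fin n → Fin B
    g = update f x (proj₁ fresh)

    avoids : ∀ {v} → v ≢ x → v ∈ near x → g x ≢ g v
    avoids v≢x v∈x eq = proj₂ fresh (subst (_∈ map f (near x))
      (trans (sym (update-≢ f _ v≢x)) (trans (sym eq) (update-≡ f x _))) (∈-map⁺ f v∈x))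

    ∈-tail : ∀ {v} → v ≢ x → v ∈ x ∷ xs → v ∈ xs
    ∈-tail v≢x (here v≡x) = contradiction v≡x v≢x
    ∈-tail v≢x (there v∈) = v∈

    g-proper : ∀ {u v} → u ∈ x ∷ xs → v ∈ x ∷ xs → u ≢ v → u ∈ near v → v ∈ near u → g u ≢ g v
    g-proper {u} {v} u∈ v∈ u≢v u∈v v∈u = by-cases (u Fin.≟ x) (v Fin.≟ x)
      where
      by-cases : Dec (u ≡ x) → Dec (v ≡ x) → g u ≢ g v
      by-cases (yes refl) _ = avoids (u≢v ∘ sym) v∈u
      by-cases (no _) (yes refl) = avoids u≢v u∈v ∘ sym
      by-cases (no u≢x) (no v≢x) eq = proper (∈-tail u≢x u∈) (∈-tail v≢x v∈) u≢v u∈v v∈u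
        (trans (sym (update-≢ f _ u≢x)) (trans eq (update-≢ f _ v≢x)))

-- Exponential inequalities.

m<2^m : ∀ m → m < 2 ^ m
m<2^m zero = s≤s z≤n
m<2^m (suc m) = begin-strict
  suc m           <⟨ s≤s (m<2^m m) ⟩
  1 + 2 ^ m       ≤⟨ +-monoˡ-≤ (2 ^ m) (m^n>0 2 m) ⟩
  2 ^ m + 2 ^ m   ≡⟨ cong (λ x → 2 ^ m + x) (+-identityʳ (2 ^ m)) ⟨
  2 ^ suc m       ∎
  where open ≤-Reasoning

-- Bernoulli's inequality (1 + 1/p)^n ≥ 1 + n/p, times p^(n+1).
bernoulli : ∀ p n → (p + n) * p ^ n ≤ p * suc p ^ n
bernoulli p zero = ≤-reflexive (cong (_* 1) (+-identityʳ p))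
bernoulli p (suc n) = begin
  (p + suc n) * (p * p ^ n)              ≡⟨ expand p n (p ^ n) ⟩
  p * ((p + n) * p ^ n) + p * p ^ n      ≤⟨ +-monoʳ-≤ (p * ((p + n) * p ^ n)) (*-monoˡ-≤ (p ^ n) (m≤m+n p n)) ⟩
  p * ((p + n) * p ^ n) + (p + n) * p ^ n ≡⟨ +-comm _ ((p + n) * p ^ n) ⟩
  suc p * ((p + n) * p ^ n)              ≤⟨ *-monoʳ-≤ (suc p) (bernoulli p n) ⟩
  suc p * (p * suc p ^ n)                ≡⟨ x∙yz≈y∙xz *-commutativeSemigroup (suc p) p (suc p ^ n) ⟩
  p * (suc p * suc p ^ n)                ∎
  where
  open ≤-Reasoning
  expand : ∀ p n x → (p + suc n) * (p * x) ≡ p * ((p + n) * x) + p * x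
  expand = solve-∀

-- Bernoulli's inequality at `n = suc p`. With `q = suc p` it reads (1 - 1/q)^q ≤ 1/2.
2*p^1+p≤1+p^1+p : ∀ p .{{_ : NonZero p}} → 2 * p ^ suc p ≤ suc p ^ suc p
2*p^1+p≤1+p^1+p p = *-cancelˡ-≤ p (begin
  p * (2 * p ^ suc p)          ≡⟨ reorder p (p ^ suc p) ⟩
  (p + p) * p ^ suc p          ≤⟨ *-monoˡ-≤ (p ^ suc p) (+-monoʳ-≤ p (n≤1+n p)) ⟩
  (p + suc p) * p ^ suc p      ≤⟨ bernoulli p (suc p) ⟩
  p * suc p ^ suc p            ∎)
  where
  open ≤-Reasoning
  reorder : ∀ p x → p * (2 * x) ≡ (p + p) * x
  reorder = solve-∀

^-distribʳ-* : ∀ n x y → (x * y) ^ n ≡ x ^ n * y ^ n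
^-distribʳ-* zero x y = refl
^-distribʳ-* (suc n) x y = trans (cong (x * y *_) (^-distribʳ-* n x y)) (interchange *-commutativeSemigroup x y (x ^ n) (y ^ n))

-- With `q = suc p`, the power (1 - 1/q)^(q a) is at most 2^(-a), and any further step drops
-- strictly below, against the hypothesis.
decay-time : ∀ p a t .{{_ : NonZero p}} → suc p ^ t ≤ p ^ t * 2 ^ a → t ≤ suc p * a
decay-time p a t hyp with t ≤? suc p * a
... | yes t≤ = t≤
... | no t≰ = contradiction hyp (<⇒≱ (subst (λ t → p ^ t * 2 ^ a < suc p ^ t) (m+[n∸m]≡n (≰⇒> t≰)) (begin-strict
  p ^ (suc (q * a) + d) * 2 ^ a           ≡⟨ cong (_* 2 ^ a) (split p) ⟩
  (p ^ q) ^ a * p ^ suc d * 2 ^ a         ≡⟨ rearrange ((p ^ q) ^ a) (p ^ suc d) (2 ^ a) ⟩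
  (2 ^ a * (p ^ q) ^ a) * p ^ suc d       ≡⟨ cong (_* p ^ suc d) (^-distribʳ-* a 2 (p ^ q)) ⟨
  (2 * p ^ q) ^ a * p ^ suc d             ≤⟨ *-monoˡ-≤ (p ^ suc d) (^-monoˡ-≤ a (2*p^1+p≤1+p^1+p p)) ⟩
  (q ^ q) ^ a * p ^ suc d                 <⟨ *-monoʳ-< ((q ^ q) ^ a) {{m^n≢0 (q ^ q) a {{m^n≢0 q q}}}} (^-monoˡ-< (suc d) (n<1+n p)) ⟩
  (q ^ q) ^ a * q ^ suc d                 ≡⟨ split q ⟨
  q ^ (suc (q * a) + d)                   ∎)))
  where
  open ≤-Reasoning
  q = suc p
  d = t ∸ suc (q * a)
  split : ∀ x → x ^ (suc (q * a) + d) ≡ (x ^ q) ^ a * x ^ suc d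
  split x = trans (cong (x ^_) (sym (+-suc (q * a) d)))
    (trans (^-distribˡ-+-* x (q * a) (suc d)) (cong (_* x ^ suc d) (sym (^-*-assoc x q a))))
  rearrange : ∀ x y z → x * y * z ≡ (z * x) * y
  rearrange = solve-∀

-- Cyclic indices.

at : ∀ {ℓ} → Fin (suc ℓ) → ℕ → Fin (suc ℓ)
at {ℓ} i s = (toℕ i + s) mod suc ℓ

module _ {ℓ : ℕ} (i : Fin (suc ℓ)) where

  toℕ-at : ∀ s → toℕ (at i s) ≡ (toℕ i + s) % suc ℓ
  toℕ-at s = Fin.toℕ-fromℕ< _

  at-suc : ∀ s → at (at i s) 1 ≡ at i (suc s)
  at-suc s = Fin.toℕ-injective (begin
    toℕ (at (at i s) 1)                                       ≡⟨ Fin.toℕ-fromℕ< _ ⟩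
    (toℕ (at i s) + 1) % suc ℓ                                ≡⟨ cong (λ a → (a + 1) % suc ℓ) (toℕ-at s) ⟩
    ((toℕ i + s) % suc ℓ + 1) % suc ℓ                         ≡⟨ %-distribˡ-+ ((toℕ i + s) % suc ℓ) 1 (suc ℓ) ⟩
    ((toℕ i + s) % suc ℓ % suc ℓ + 1 % suc ℓ) % suc ℓ         ≡⟨ cong (λ a → (a + 1 % suc ℓ) % suc ℓ) (m%n%n≡m%n (toℕ i + s) (suc ℓ)) ⟩
    ((toℕ i + s) % suc ℓ + 1 % suc ℓ) % suc ℓ                 ≡⟨ %-distribˡ-+ (toℕ i + s) 1 (suc ℓ) ⟨
    (toℕ i + s + 1) % suc ℓ                                   ≡⟨ cong (_% suc ℓ) (trans (+-comm (toℕ i + s) 1) (sym (+-suc (toℕ i) s))) ⟩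
    (toℕ i + suc s) % suc ℓ                                   ≡⟨ toℕ-at (suc s) ⟨
    toℕ (at i (suc s))                                        ∎)
    where open ≡-Reasoning

  at-period : at i (suc ℓ) ≡ i
  at-period = Fin.toℕ-injective (trans (toℕ-at (suc ℓ))
    (trans ([m+n]%n≡m%n (toℕ i) (suc ℓ)) (m<n⇒m%n≡m (Fin.toℕ<n i))))

  -- A shift by `s` either does not wrap and increases the index, or wraps once and decreases it.
  at-≢ : ∀ {s} → 0 < s → s < suc ℓ → at i s ≢ i
  at-≢ {s} 0<s s<ℓ eq with toℕ i + s <? suc ℓ
  ... | yes below = contradiction (trans (sym (trans (toℕ-at s) (m<n⇒m%n≡m below))) (cong toℕ eq))
    (<⇒≢ (m<m+n (toℕ i) 0<s) ∘ sym)
  ... | no ¬below = contradiction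
    (trans (sym (trans (toℕ-at s) (trans (sym (m≤n⇒[n∸m]%m≡n%m (≮⇒≥ ¬below))) (m<n⇒m%n≡m (<-trans wrapped (Fin.toℕ<n i)))))) (cong toℕ eq))
    (<⇒≢ wrapped)
    where
    wrapped : toℕ i + s ∸ suc ℓ < toℕ i
    wrapped = subst (toℕ i + s ∸ suc ℓ <_) (m+n∸n≡m (toℕ i) s) (∸-monoʳ-< s<ℓ (≮⇒≥ ¬below))

-- Edge lists: degrees, walks, balls and cycles.

module _ {n : ℕ} where

  private
    V = Fin n

  -- Both orientations of each listed edge: adjacency becomes membership, and a degree counts the
  -- darts leaving a vertex.
  darts : List (V × V) → List (V × V)
  darts [] = []
  darts ((u , v) ∷ H) = (u , v) ∷ (v , u) ∷ darts H

  length-darts : ∀ H → length (darts H) ≡ 2 * length H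
  length-darts [] = refl
  length-darts (_ ∷ H) = trans (cong (suc ∘ suc) (length-darts H)) (sym (*-suc 2 (length H)))

  darts-sym : ∀ H {u v} → (u , v) ∈ darts H → (v , u) ∈ darts H
  darts-sym (_ ∷ H) (here refl) = there (here refl)
  darts-sym (_ ∷ H) (there (here refl)) = here refl
  darts-sym (_ ∷ H) (there (there uv)) = there (there (darts-sym H uv))

  ∈⇒∈darts : ∀ H {e} → e ∈ H → e ∈ darts H
  ∈⇒∈darts (_ ∷ H) (here refl) = here refl
  ∈⇒∈darts (_ ∷ H) (there e∈) = there (there (∈⇒∈darts H e∈))

  ∈darts⇒∈ : ∀ H {u v} → (u , v) ∈ darts H → (u , v) ∈ H ⊎ (v , u) ∈ H
  ∈darts⇒∈ (_ ∷ H) (here refl) = inj₁ (here refl)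
  ∈darts⇒∈ (_ ∷ H) (there (here refl)) = inj₂ (here refl)
  ∈darts⇒∈ (_ ∷ H) (there (there uv)) with ∈darts⇒∈ H uv
  ... | inj₁ uv∈ = inj₁ (there uv∈)
  ... | inj₂ vu∈ = inj₂ (there vu∈)

  degree : List (V × V) → V → ℕ
  degree D v = count (λ d → v Fin.≟ proj₁ d) D

  nbrs : List (V × V) → V → List V
  nbrs D v = map proj₂ (filter (λ d → v Fin.≟ proj₁ d) D)

  count-unique : ∀ x {W : List V} → Unique W → count (Fin._≟ x) W ≤ 1
  count-unique x [] = z≤n
  count-unique x {w ∷ W} (w∉W ∷ unique) with w Fin.≟ x
  ... | yes refl = s≤s (≤-reflexive (cong length (filter-none (Fin._≟ x) (All.map (λ ≢ → ≢ ∘ sym) w∉W))))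
  ... | no _ = count-unique x unique

  -- Double counting of incidences: since `Z` has no repetitions, each dart leaves at most one entry
  -- of `Z`.
  saturated-bound : ∀ D d {Z} → Unique Z → (∀ {v} → v ∈ Z → d ≤ degree D v) → length Z * d ≤ length D
  saturated-bound D d {Z} unique large = begin
    length Z * d                                          ≤⟨ sum-*-≥ (degree D) 1 d Z (λ v∈ → ≤-trans (large v∈) (≤-reflexive (sym (*-identityʳ _)))) ⟩
    sum (map (degree D) Z) * 1                            ≡⟨ cong (_* 1) (double-count (λ v d → v Fin.≟ proj₁ d) Z D) ⟩
    sum (map (λ d → count (Fin._≟ proj₁ d) Z) D) * 1      ≤⟨ sum-*-≤ _ 1 1 D (λ {d} _ → *-monoˡ-≤ 1 (count-unique (proj₁ d) unique)) ⟩
    length D * 1                                          ≡⟨ *-identityʳ _ ⟩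
    length D                                              ∎
    where open ≤-Reasoning

  degree-∷ : ∀ {d u v} H → u ≢ v → degree (darts H) u < d → degree (darts H) v < d →
             (∀ w → degree (darts H) w ≤ d) → ∀ w → degree (darts ((u , v) ∷ H)) w ≤ d
  degree-∷ {u = u} {v} H u≢v u< v< all w with w Fin.≟ u
  ... | yes refl with w Fin.≟ v
  ...   | yes refl = contradiction refl u≢v
  ...   | no _     = u<
  degree-∷ {u = u} {v} H u≢v u< v< all w | no _ with w Fin.≟ v
  ...   | yes refl = v<
  ...   | no _     = all w

  -- The index is an upper bound for the length, because `stop` is available at every index.
  data Walk (D : List (V × V)) : ℕ → V → V → Set where
    stop : ∀ {s v} → Walk D s v v
    step : ∀ {s u v w} → (u , v) ∈ D → Walk D s v w → Walk D (suc s) u w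

  Walk-snoc : ∀ {D s u v w} → Walk D s u v → (v , w) ∈ D → Walk D (suc s) u w
  Walk-snoc stop e = step e stop
  Walk-snoc (step e′ walk) e = step e′ (Walk-snoc walk e)

  Walk-reverse : ∀ {H s u v} → Walk (darts H) s u v → Walk (darts H) s v u
  Walk-reverse stop = stop
  Walk-reverse {H} (step e walk) = Walk-snoc (Walk-reverse walk) (darts-sym H e)

  Walk-mono : ∀ {D s t u v} → s ≤ t → Walk D s u v → Walk D t u v
  Walk-mono _ stop = stop
  Walk-mono (s≤s s≤t) (step e walk) = step e (Walk-mono s≤t walk)

  ball : List (V × V) → ℕ → V → List V
  ball D zero v = v ∷ []
  ball D (suc s) v = v ∷ concatMap (ball D s) (nbrs D v)

  Walk⇒∈ball : ∀ {D s u v} → Walk D s u v → v ∈ ball D s u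
  Walk⇒∈ball {s = zero} stop = here refl
  Walk⇒∈ball {s = suc s} stop = here refl
  Walk⇒∈ball {D} {suc s} (step e walk) =
    there (∈-concatMap⁺ (ball D s) (lose (∈-map⁺ proj₂ (∈-filter⁺ _ e refl)) (Walk⇒∈ball walk)))

  length-concatMap-≤ : ∀ {b} (f : A → List B) → (∀ x → length (f x) ≤ b) →
                       ∀ xs → length (concatMap f xs) ≤ length xs * b
  length-concatMap-≤ f bound [] = z≤n
  length-concatMap-≤ {b = b} f bound (x ∷ xs) = begin
    length (f x ++ concatMap f xs)           ≡⟨ length-++ (f x) ⟩
    length (f x) + length (concatMap f xs)   ≤⟨ +-mono-≤ (bound x) (length-concatMap-≤ f bound xs) ⟩
    b + length xs * b                        ∎
    where open ≤-Reasoning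

  length-ball : ∀ {d} D → (∀ v → degree D v ≤ d) → ∀ s v → length (ball D s v) ≤ suc d ^ s
  length-ball D deg≤ zero v = ≤-refl
  length-ball {d} D deg≤ (suc s) v = begin
    suc (length (concatMap (ball D s) (nbrs D v)))   ≤⟨ s≤s (length-concatMap-≤ (ball D s) (length-ball D deg≤ s) (nbrs D v)) ⟩
    suc (length (nbrs D v) * suc d ^ s)              ≡⟨ cong (λ l → suc (l * suc d ^ s)) (length-map proj₂ (filter _ D)) ⟩
    suc (degree D v * suc d ^ s)                     ≤⟨ +-mono-≤ (m^n>0 (suc d) s) (*-monoˡ-≤ (suc d ^ s) (deg≤ v)) ⟩
    suc d ^ s + d * suc d ^ s                        ∎
    where open ≤-Reasoning

  -- A cycle whose closing edge is the step that wraps around, so that all its edges are treated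
  -- alike.
  IsTour : List (V × V) → ∀ {ℓ} → (Fin (suc ℓ) → V) → Set
  IsTour D x = Injective _≡_ _≡_ x × (∀ i → (x i , x (at i 1)) ∈ D)

  -- The condition `2 ≤ ℓ` sets aside the tours of length two, which go back and forth along one
  -- edge.
  NoTourBelow : ℕ → List (V × V) → Set
  NoTourBelow r D = ∀ {ℓ} → 2 ≤ ℓ → suc ℓ < r → (x : Fin (suc ℓ) → V) → ¬ IsTour D x

  -- A short tour must use the new edge. Its remaining steps use old darts only and form a walk of
  -- length below `r` between `u` and `v`, which `far` excludes.
  noTour-∷ : ∀ {r u v} H → v ∉ ball (darts H) r u →
             NoTourBelow r (darts H) → NoTourBelow r (darts ((u , v) ∷ H))
  noTour-∷ {r} {u} {v} H far noTour {ℓ} 2≤ℓ ℓ<r x (inj , edges)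
    with Fin.any? (λ i → ≡-dec Fin._≟_ Fin._≟_ (x i , x (at i 1)) (u , v)
                    ⊎-dec ≡-dec Fin._≟_ Fin._≟_ (x i , x (at i 1)) (v , u))
  ... | no old = noTour 2≤ℓ ℓ<r x (inj , λ i → case-old (edges i) (λ new → old (i , new)))
    where
    case-old : ∀ {e} → e ∈ (u , v) ∷ (v , u) ∷ darts H → ¬ (e ≡ (u , v) ⊎ e ≡ (v , u)) → e ∈ darts H
    case-old (here e≡) ¬new = contradiction (inj₁ e≡) ¬new
    case-old (there (here e≡)) ¬new = contradiction (inj₂ e≡) ¬new
    case-old (there (there e∈)) _ = e∈
  ... | yes (j , new) = far (Walk⇒∈ball (oriented new))
    where
    at≢ : ∀ s → 0 < s → s ≤ ℓ → x (at j s) ≢ x j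
    at≢ s 0<s s≤ℓ = at-≢ j 0<s (s≤s s≤ℓ) ∘ inj

    -- Traversing the new edge backwards at step `s` would bring the tour back to `x j` after two
    -- steps, but its length is at least three.
    crosses : ∀ s → 0 < s → s ≤ ℓ → x (at j s) ≡ x (at j 1) → x (at j (suc s)) ≢ x j
    crosses s 0<s s≤ℓ eq eq′ = at≢ 2 (s≤s z≤n) 2≤ℓ
      (trans (cong x (trans (sym (at-suc j 1)) (trans (cong (λ i → at i 1) (sym (inj eq))) (at-suc j s)))) eq′)

    old : ∀ s → 0 < s → s ≤ ℓ → (x (at j s) , x (at j (suc s))) ∈ darts H
    old s 0<s s≤ℓ = excluding-new (subst (λ i → (x (at j s) , x i) ∈ _) (at-suc j s) (edges (at j s))) new
      where
      excluding-new : (x (at j s) , x (at j (suc s))) ∈ (u , v) ∷ (v , u) ∷ darts H →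
                      (x j , x (at j 1)) ≡ (u , v) ⊎ (x j , x (at j 1)) ≡ (v , u) →
                      (x (at j s) , x (at j (suc s))) ∈ darts H
      excluding-new (there (there e)) _ = e
      excluding-new (here eq) (inj₁ eq′) = contradiction (cong proj₁ (trans eq (sym eq′))) (at≢ s 0<s s≤ℓ)
      excluding-new (there (here eq)) (inj₂ eq′) = contradiction (cong proj₁ (trans eq (sym eq′))) (at≢ s 0<s s≤ℓ)
      excluding-new (here eq) (inj₂ eq′) = contradiction (trans (cong proj₂ eq) (sym (cong proj₁ eq′)))
        (crosses s 0<s s≤ℓ (trans (cong proj₁ eq) (sym (cong proj₂ eq′))))
      excluding-new (there (here eq)) (inj₁ eq′) = contradiction (trans (cong proj₂ eq) (sym (cong proj₁ eq′)))
        (crosses s 0<s s≤ℓ (trans (cong proj₁ eq) (sym (cong proj₂ eq′))))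

    walk : ∀ t s → 0 < s → t + s ≡ suc ℓ → Walk (darts H) t (x (at j s)) (x j)
    walk zero s _ refl = subst (λ i → Walk (darts H) 0 (x i) (x j)) (sym (at-period j)) stop
    walk (suc t) s 0<s eq = step (old s 0<s (≤-trans (m≤n+m s t) (≤-reflexive (suc-injective eq))))
      (walk t (suc s) (s≤s z≤n) (trans (+-suc t s) eq))

    around : Walk (darts H) r (x (at j 1)) (x j)
    around = Walk-mono (<⇒≤ (<-trans (n<1+n ℓ) ℓ<r)) (walk ℓ 1 (s≤s z≤n) (+-comm ℓ 1))

    oriented : (x j , x (at j 1)) ≡ (u , v) ⊎ (x j , x (at j 1)) ≡ (v , u) → Walk (darts H) r u v
    oriented (inj₁ refl) = Walk-reverse {H} around
    oriented (inj₂ refl) = around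

-- Arcs of a graph, and colourings of vertex subsets.

edges : (G : Graph) → List (Vertex G × Vertex G)
edges G = filter (IsEdge? G) (cartesianProduct (allFin (order G)) (allFin (order G)))

arcs : (G : Graph) → List (Vertex G × Vertex G)
arcs G = darts (edges G)

∈edges : ∀ G {u v} → u Fin.< v → Adj G u v → (u , v) ∈ edges G
∈edges G u<v uv = ∈-filter⁺ (IsEdge? G) (∈-cartesianProduct⁺ (∈-allFin _) (∈-allFin _)) (u<v , uv)

Adj⇒∈arcs : ∀ G {u v} → Adj G u v → (u , v) ∈ arcs G
Adj⇒∈arcs G {u} {v} uv with Fin.<-cmp u v
... | tri< u<v _ _ = ∈⇒∈darts (edges G) (∈edges G u<v uv)
... | tri≈ _ refl _ = contradiction uv (Graph.irreflexive G u)
... | tri> _ _ v<u = darts-sym (edges G) (∈⇒∈darts (edges G) (∈edges G v<u (Graph.symmetric G _ _ uv)))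

∈arcs⇒Adj : ∀ G {u v} → (u , v) ∈ arcs G → Adj G u v
∈arcs⇒Adj G {u} {v} uv with ∈darts⇒∈ (edges G) uv
... | inj₁ e = proj₂ (proj₂ (∈-filter⁻ (IsEdge? G) {xs = cartesianProduct (allFin _) (allFin _)} e))
... | inj₂ e = Graph.symmetric G _ _ (proj₂ (proj₂ (∈-filter⁻ (IsEdge? G) {xs = cartesianProduct (allFin _) (allFin _)} e)))

-- Colourability of the subgraph induced on `W`. The colouring is a total function whose values off
-- `W` are arbitrary.
ColorableOn : (G : Graph) → List (Vertex G) → ℕ → Set
ColorableOn G W c = ∃ λ (f : Vertex G → Fin c) → ∀ {u v} → u ∈ W → v ∈ W → Adj G u v → f u ≢ f v

length-cartesianProductWith : {C : Set} (f : A → B → C) → ∀ xs ys →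
  length (cartesianProductWith f xs ys) ≡ length xs * length ys
length-cartesianProductWith f [] ys = refl
length-cartesianProductWith f (x ∷ xs) ys = trans (length-++ (map (f x) ys))
  (cong₂ _+_ (length-map (f x) ys) (length-cartesianProductWith f xs ys))

↑ˡ≢↑ʳ : ∀ {m n} (i : Fin m) (j : Fin n) → i ↑ˡ n ≢ m ↑ʳ j
↑ˡ≢↑ʳ {m} {n} i j eq
  with () ← trans (sym (Fin.splitAt-↑ˡ m i n)) (trans (cong (Fin.splitAt m) eq) (Fin.splitAt-↑ʳ m n j))

count-× : {P Q R : A → Set} (P? : Decidable P) (Q? : Decidable Q) (R? : Decidable R) →
          (∀ {x} → P x → Q x × R x) → ∀ xs → count P? xs ≤ count Q? (filter R? xs)
count-× P? Q? R? split [] = z≤n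
count-× P? Q? R? split (x ∷ xs) with P? x | R? x
... | no _  | no _   = count-× P? Q? R? split xs
... | yes p | no ¬r  = contradiction (proj₂ (split p)) ¬r
... | no _  | yes _ with Q? x
...   | yes _ = m≤n⇒m≤1+n (count-× P? Q? R? split xs)
...   | no _  = count-× P? Q? R? split xs
count-× P? Q? R? split (x ∷ xs) | yes p | yes _ with Q? x
...   | yes _ = s≤s (count-× P? Q? R? split xs)
...   | no ¬q = contradiction (proj₁ (split p)) ¬q

-- Monochromatic edges, refinements and lists of colourings.

module _ {n : ℕ} where

  Mono : {c : ℕ} → (Fin n → Fin c) → Fin n × Fin n → Set
  Mono f (u , v) = f u ≡ f v

  mono? : {c : ℕ} (f : Fin n → Fin c) (e : Fin n × Fin n) → Dec (Mono f e)
  mono? f (u , v) = f u Fin.≟ f v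

module _ {n k : ℕ} where

  -- Random choice made deterministic: by `averaging`, some `f` in `F` keeps at most a 1/q fraction
  -- of the edges still monochromatic under `g`, and pairing `f` with `g` keeps only those.
  common-refinement : ∀ q (F : List (Fin n → Fin k)) E → 0 < length F →
    (∀ {e} → e ∈ E → count (λ f → mono? f e) F * q ≤ length F) →
    ∀ m → ∃ λ (g : Fin n → Fin (k ^ m)) → count (mono? g) E * q ^ m ≤ length E
  common-refinement q F E nonempty rare zero =
    (λ _ → Fin.zero) , ≤-trans (≤-reflexive (*-identityʳ _)) (length-filter (mono? _) E)
  common-refinement q F E nonempty rare (suc m)
    with g , g-few ← common-refinement q F E nonempty rare m
    with f , f-few ← averaging (λ f e → mono? f e) q F (filter (mono? g) E) nonempty
                       (λ e∈ → rare (proj₁ (∈-filter⁻ (mono? g) {xs = E} e∈)))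
    = (λ v → combine (f v) (g v)) , (begin
      count (mono? _) E * (q * q ^ m)               ≤⟨ *-monoˡ-≤ (q * q ^ m) (count-× (mono? _) (mono? f) (mono? g) (Fin.combine-injective _ _ _ _) E) ⟩
      count (mono? f) (filter (mono? g) E) * (q * q ^ m)   ≡⟨ *-assoc (count (mono? f) (filter (mono? g) E)) q _ ⟨
      count (mono? f) (filter (mono? g) E) * q * q ^ m     ≤⟨ *-monoˡ-≤ (q ^ m) f-few ⟩
      count (mono? g) E * q ^ m                     ≤⟨ g-few ⟩
      length E                                      ∎)
    where open ≤-Reasoning

  -- After `m` refinements fewer than one edge, hence none, is monochromatic.
  separating-coloring : ∀ q (F : List (Fin n → Fin k)) E m → 0 < length F → length E < q ^ m →
    (∀ {e} → e ∈ E → count (λ f → mono? f e) F * q ≤ length F) →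
    ∃ λ (g : Fin n → Fin (k ^ m)) → ∀ {e} → e ∈ E → ¬ Mono g e
  separating-coloring q F E m nonempty E<q^m rare
    with g , few ← common-refinement q F E nonempty rare m
    = g , λ e∈ mono → contradiction few (<⇒≱ (begin-strict
      length E                      <⟨ E<q^m ⟩
      q ^ m                         ≡⟨ *-identityˡ (q ^ m) ⟨
      1 * q ^ m                     ≤⟨ *-monoˡ-≤ (q ^ m) (∈⇒0<length (∈-filter⁺ (mono? g) e∈ mono)) ⟩
      count (mono? g) E * q ^ m     ∎))
    where
    open ≤-Reasoning
    ∈⇒0<length : {x : A} {xs : List A} → x ∈ xs → 0 < length xs
    ∈⇒0<length (here _) = s≤s z≤n
    ∈⇒0<length (there _) = s≤s z≤n

  module _ (c₀ : Fin k) where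

    -- One colouring for each choice of colours on W, constantly c₀ elsewhere, so that
    -- a colouring of the whole graph is represented up to its values off W.
    colorings : List (Fin n) → List (Fin n → Fin k)
    colorings [] = (λ _ → c₀) ∷ []
    colorings (w ∷ W) = cartesianProductWith (λ c f → update f w c) (allFin k) (colorings W)

    length-colorings : ∀ W → length (colorings W) ≡ k ^ length W
    length-colorings [] = refl
    length-colorings (w ∷ W) = trans (length-cartesianProductWith _ (allFin k) (colorings W))
      (trans (cong (length (allFin k) *_) (length-colorings W))
        (cong (_* k ^ length W) (length-tabulate {n = k} id)))

    colorings-complete : ∀ (g : Fin n → Fin k) W → ∃[ f ] f ∈ colorings W × (∀ {v} → v ∈ W → f v ≡ g v)
    colorings-complete g [] = _ , here refl , λ ()
    colorings-complete g (w ∷ W) with f , f∈ , agree ← colorings-complete g W =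
      update f w (g w) , ∈-cartesianProductWith⁺ _ (∈-allFin (g w)) f∈ , agree′
      where
      agree′ : ∀ {v} → v ∈ w ∷ W → update f w (g w) v ≡ g v
      agree′ {v} v∈ with v Fin.≟ w | v∈
      ... | yes refl | _ = refl
      ... | no v≢w | here v≡w = contradiction v≡w v≢w
      ... | no _ | there v∈W = agree v∈W

    survivors : List (Fin n) → List (Fin n × Fin n) → List (Fin n → Fin k)
    survivors W [] = colorings W
    survivors W (e ∷ H) = filter (λ f → ¬? (mono? f e)) (survivors W H)

    ∈survivors : ∀ {W f} H → f ∈ colorings W → (∀ {e} → e ∈ H → ¬ Mono f e) → f ∈ survivors W H
    ∈survivors [] f∈ _ = f∈
    ∈survivors (e ∷ H) f∈ proper =
      ∈-filter⁺ _ (∈survivors H f∈ (proper ∘ there)) (proper (here refl))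

-- The edge-by-edge construction and its rounds.

module _ (G : Graph) (r k : ℕ) where

  record SparseSubgraph : Set where
    field
      edgeSet  : List (Vertex G × Vertex G)
      inside   : ∀ {u v} → (u , v) ∈ edgeSet → Adj G u v
      noTour   : NoTourBelow r (darts edgeSet)
      uncolorable : ¬ (∃ λ (f : Vertex G → Fin k) → ∀ {e} → e ∈ edgeSet → ¬ Mono f e)

module Construction (G : Graph) (r k p m : ℕ) .{{_ : NonZero p}} .{{_ : NonZero k}}
                    (few-arcs : length (arcs G) < suc p ^ m) where

  private
    V = Vertex G
    q = suc p

    c₀ : Fin k
    c₀ = Fin.fromℕ< (>-nonZero⁻¹ k)

  -- At most `q * (k * length W)` edges get chosen while a colouring survives. They have twice as
  -- many darts, so at most a 1/k fraction of `W` can have this degree.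
  maxDegree : ℕ
  maxDegree = 2 * (q * (k * k))

  -- The classes of the separating colouring, times the colours of a greedy colouring for balls of
  -- size at most `suc maxDegree ^ r`; the outer `suc` is the spare colour that greedy colouring
  -- needs.
  colorLoss : ℕ
  colorLoss = k ^ m * suc (suc maxDegree ^ r)

  record Shrinks (W : List V) : Set where
    field
      core    : List V
      unique  : Unique core
      small   : length core * k ≤ length W
      extends : ∀ c → ColorableOn G core c → ColorableOn G W (colorLoss + c)

  module _ (W : List V) (W-unique : Unique W) where

    Surviving : List (V × V) → List (V → Fin k)
    Surviving = survivors c₀ W

    record Stage (H : List (V × V)) : Set where
      field
        within  : ∀ {u v} → (u , v) ∈ H → u ∈ W × v ∈ W
        inside  : ∀ {u v} → (u , v) ∈ H → Adj G u v
        degrees : ∀ v → degree (darts H) v ≤ maxDegree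
        noTour  : NoTourBelow r (darts H)
        -- At most (1 - 1/q)^|H| k^|W| colourings survive.
        decay   : length (Surviving H) * q ^ length H ≤ p ^ length H * k ^ length W

    -- The last clause says that more than a 1/q fraction of the surviving colourings would die.
    -- Adjacency in `G` is absent because candidates are drawn from `arcs G`.
    Addable : List (V × V) → V × V → Set
    Addable H (u , v) = (u ∈ W × v ∈ W) × (degree (darts H) u < maxDegree × degree (darts H) v < maxDegree)
      × v ∉ ball (darts H) r u
      × length (Surviving H) < count (λ f → mono? f (u , v)) (Surviving H) * q

    addable? : ∀ H → Decidable (Addable H)
    addable? H (u , v) = (Any.any? (u Fin.≟_) W ×-dec Any.any? (v Fin.≟_) W)
      ×-dec (degree (darts H) u <? maxDegree ×-dec degree (darts H) v <? maxDegree)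
      ×-dec ¬? (Any.any? (v Fin.≟_) (ball (darts H) r u))
      ×-dec length (Surviving H) <? count (λ f → mono? f (u , v)) (Surviving H) * q

    stage-[] : Stage []
    stage-[] = record
      { within = λ () ; inside = λ () ; degrees = λ _ → z≤n
      ; noTour = λ _ _ x (_ , tour) → contradiction (tour Fin.zero) λ ()
      ; decay = ≤-reflexive (trans (*-identityʳ _) (trans (length-colorings c₀ W) (sym (*-identityˡ _))))
      }

    survivors-split : ∀ H e → length (Surviving (e ∷ H)) + count (λ f → mono? f e) (Surviving H) ≡ length (Surviving H)
    survivors-split H e = count-complement (λ f → mono? f e) (Surviving H)

    stage-∷ : ∀ {H u v} → Adj G u v → Stage H → Addable H (u , v) → Stage ((u , v) ∷ H)
    stage-∷ {H} {u} {v} uv stage (uv∈W , (u< , v<) , far , popular) = record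
      { within  = λ { (here refl) → uv∈W ; (there e) → within e }
      ; inside  = λ { (here refl) → uv ; (there e) → inside e }
      ; degrees = degree-∷ H (λ { refl → Graph.irreflexive G u uv }) u< v< degrees
      ; noTour  = noTour-∷ H far noTour
      ; decay   = begin
          F′ * (q * q ^ t)             ≡⟨ *-assoc F′ q _ ⟨
          F′ * q * q ^ t               ≤⟨ *-monoˡ-≤ (q ^ t) drop ⟩
          F * p * q ^ t                ≡⟨ trans (cong (_* q ^ t) (*-comm F p)) (*-assoc p F _) ⟩
          p * (F * q ^ t)              ≤⟨ *-monoʳ-≤ p decay ⟩
          p * (p ^ t * k ^ length W)   ≡⟨ *-assoc p _ _ ⟨
          p * p ^ t * k ^ length W     ∎
      }
      where
      open Stage stage
      open ≤-Reasoning
      t = length H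
      F = length (Surviving H)
      F′ = length (Surviving ((u , v) ∷ H))
      C = count (λ f → mono? f (u , v)) (Surviving H)
      -- From `F = F′ + C` and `F < C * q`: at most a p/q fraction survives.
      drop : F′ * q ≤ F * p
      drop = +-cancelʳ-≤ (C * q) (F′ * q) (F * p) (begin
        F′ * q + C * q   ≡⟨ *-distribʳ-+ q F′ C ⟨
        (F′ + C) * q     ≡⟨ cong (_* q) (survivors-split H (u , v)) ⟩
        F * q            ≡⟨ trans (*-suc F p) (+-comm F (F * p)) ⟩
        F * p + F        ≤⟨ +-monoʳ-≤ (F * p) (<⇒≤ popular) ⟩
        F * p + C * q    ∎)

    -- Popularity forces at least one colouring to die, so the number of survivors can serve as
    -- fuel.
    addable-decreases : ∀ {H e} → Addable H e → length (Surviving (e ∷ H)) < length (Surviving H)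
    addable-decreases {H} {e} (_ , _ , _ , popular) =
      subst (length (Surviving (e ∷ H)) <_) (survivors-split H e) (m<m+n (length (Surviving (e ∷ H)))
        (n≢0⇒n>0 λ C≡0 → n≮0 (subst (λ C → length (Surviving H) < C * q) C≡0 popular)))

    -- A proper colouring of the edges of `H` agrees on `W` with a listed one; since these edges lie
    -- within `W`, the listed one would have survived.
    extinct : ∀ {H} → Stage H → length (Surviving H) ≡ 0 → SparseSubgraph G r k
    extinct {H} stage none = record
      { edgeSet = H ; inside = inside ; noTour = noTour ; uncolorable = uncolorable }
      where
      open Stage stage
      uncolorable : ¬ (∃ λ (f : V → Fin k) → ∀ {e} → e ∈ H → ¬ Mono f e)
      uncolorable (g , proper) with colorings-complete c₀ g W
      ... | f , f∈ , agree = absurd (Surviving H) none (∈survivors c₀ H f∈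
        λ {e} e∈ eq → proper e∈ (trans (sym (agree (proj₁ (within e∈)))) (trans eq (agree (proj₂ (within e∈))))))
        where
        absurd : ∀ (xs : List (V → Fin k)) {f} → length xs ≡ 0 → ¬ f ∈ xs
        absurd [] _ ()

    -- One survivor turns `decay` into a lower bound 1 for the decayed count, and k < 2^k gives it
    -- the form that `decay-time` takes.
    edges-bounded : ∀ {H} → Stage H → 0 < length (Surviving H) → length H ≤ q * (k * length W)
    edges-bounded {H} stage nonempty = decay-time p (k * length W) (length H) (begin
      q ^ length H                               ≡⟨ *-identityˡ _ ⟨
      1 * q ^ length H                           ≤⟨ *-monoˡ-≤ (q ^ length H) nonempty ⟩
      length (Surviving H) * q ^ length H        ≤⟨ Stage.decay stage ⟩
      p ^ length H * k ^ length W                ≤⟨ *-monoʳ-≤ (p ^ length H) (^-monoˡ-≤ (length W) (<⇒≤ (m<2^m k))) ⟩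
      p ^ length H * (2 ^ k) ^ length W          ≡⟨ cong (p ^ length H *_) (^-*-assoc 2 k (length W)) ⟩
      p ^ length H * 2 ^ (k * length W)          ∎)
      where open ≤-Reasoning

    -- The core is the set of saturated vertices. An unsaturated vertex gets the pair of its class
    -- under `g` and its colour under `s`: `g` separates the rare arcs, `s` the arcs joining
    -- vertices close in `H`.
    stuck : ∀ {H} → Stage H → 0 < length (Surviving H) →
            (∀ {e} → e ∈ arcs G → ¬ Addable H e) → Shrinks W
    stuck {H} stage nonempty none = record
      { core = Z ; unique = Z-unique ; small = small ; extends = extends }
      where
      open Stage stage
      F = Surviving H

      saturated? : ∀ v → Dec (maxDegree ≤ degree (darts H) v)
      saturated? v = maxDegree ≤? degree (darts H) v

      Z : List V
      Z = filter saturated? W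

      Z-unique : Unique Z
      Z-unique = Unique.filter⁺ saturated? W-unique

      small : length Z * k ≤ length W
      small = *-cancelˡ-≤ (2 * (q * k)) {{m*n≢0 2 (q * k) {{_}} {{m*n≢0 q k}}}} (begin
        2 * (q * k) * (length Z * k)      ≡⟨ rearrange q k (length Z) ⟩
        length Z * maxDegree              ≤⟨ saturated-bound (darts H) maxDegree Z-unique (λ v∈ → proj₂ (∈-filter⁻ saturated? {xs = W} v∈)) ⟩
        length (darts H)                  ≡⟨ length-darts H ⟩
        2 * length H                      ≤⟨ *-monoʳ-≤ 2 (edges-bounded stage nonempty) ⟩
        2 * (q * (k * length W))          ≡⟨ cong (2 *_) (*-assoc q k _) ⟨
        2 * (q * k * length W)            ≡⟨ *-assoc 2 (q * k) _ ⟨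
        2 * (q * k) * length W            ∎)
        where
        open ≤-Reasoning
        rearrange : ∀ q k z → 2 * (q * k) * (z * k) ≡ z * (2 * (q * (k * k)))
        rearrange = solve-∀

      rare? : Decidable (λ e → count (λ f → mono? f e) F * q ≤ length F)
      rare? e = count (λ f → mono? f e) F * q ≤? length F

      separation : ∃ λ (g : V → Fin (k ^ m)) → ∀ {e} → e ∈ filter rare? (arcs G) → ¬ Mono g e
      separation = separating-coloring q F (filter rare? (arcs G)) m nonempty
        (≤-<-trans (length-filter rare? (arcs G)) few-arcs)
        (λ e∈ → proj₂ (∈-filter⁻ rare? {xs = arcs G} e∈))

      g = proj₁ separation

      near : V → List V
      near = ball (darts H) r

      spread : ∃ λ (f : V → Fin (suc (suc maxDegree ^ r))) →
        ∀ {u v} → u ∈ allFin _ → v ∈ allFin _ → u ≢ v → u ∈ near v → v ∈ near u → f u ≢ f v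
      spread = greedy-coloring near (λ v → s≤s (length-ball (darts H) degrees r v)) (allFin _)

      s = proj₁ spread

      -- An arc inside a class of `g` is not rare, so with both ends unsaturated only nearness can
      -- prevent its addition.
      close : ∀ {u v} → u ∈ W → v ∈ W → degree (darts H) u < maxDegree → degree (darts H) v < maxDegree →
              Adj G u v → g u ≡ g v → v ∈ near u
      close {u} {v} u∈ v∈ u< v< uv eq = decidable-stable (Any.any? (v Fin.≟_) (near u)) λ far →
        none (Adj⇒∈arcs G uv) ((u∈ , v∈) , (u< , v<) , far ,
          ≰⇒> (λ rare → proj₂ separation (∈-filter⁺ rare? (Adj⇒∈arcs G uv) rare) eq))

      extends : ∀ c → ColorableOn G Z c → ColorableOn G W (colorLoss + c)
      extends c (f , f-proper) = (λ v → color v (saturated? v)) ,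
        λ {u} {v} u∈ v∈ uv → proper u∈ v∈ uv (saturated? u) (saturated? v)
        where
        color : ∀ v → Dec (maxDegree ≤ degree (darts H) v) → Fin (colorLoss + c)
        color v (yes _) = colorLoss ↑ʳ f v
        color v (no _)  = combine (g v) (s v) ↑ˡ c

        proper : ∀ {u v} → u ∈ W → v ∈ W → Adj G u v → ∀ u? v? → color u u? ≢ color v v?
        proper u∈ v∈ uv (yes u≥) (yes v≥) eq =
          f-proper (∈-filter⁺ saturated? u∈ u≥) (∈-filter⁺ saturated? v∈ v≥) uv (Fin.↑ʳ-injective colorLoss _ _ eq)
        proper u∈ v∈ uv (yes _) (no _) eq = ↑ˡ≢↑ʳ _ _ (sym eq)
        proper u∈ v∈ uv (no _) (yes _) eq = ↑ˡ≢↑ʳ _ _ eq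
        proper {u} {v} u∈ v∈ uv (no u≱) (no v≱) eq
          with g≡ , s≡ ← Fin.combine-injective (g u) (s u) (g v) (s v) (Fin.↑ˡ-injective c _ _ eq) =
          proj₂ spread (∈-allFin u) (∈-allFin v) (λ { refl → Graph.irreflexive G u uv })
            -- Greedy colouring needs nearness both ways; applying `close` to both orientations of
            -- the arc supplies it.
            (close v∈ u∈ (≰⇒> v≱) (≰⇒> u≱) (Graph.symmetric G u v uv) (sym g≡))
            (close u∈ v∈ (≰⇒> u≱) (≰⇒> v≱) uv g≡) s≡

    run : ∀ fuel {H} → Stage H → length (Surviving H) ≤ fuel → SparseSubgraph G r k ⊎ Shrinks W
    run zero stage F≤ = inj₁ (extinct stage (n≤0⇒n≡0 F≤))
    run (suc fuel) {H} stage F≤ with 0 <? length (Surviving H)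
    ... | no ¬F = inj₁ (extinct stage (n≤0⇒n≡0 (≮⇒≥ ¬F)))
    ... | yes nonempty with Any.any? (addable? H) (arcs G)
    ...   | no none = inj₂ (stuck stage nonempty λ e∈ add → none (lose e∈ add))
    ...   | yes some with (u , v) , e∈ , add ← find some =
      run fuel (stage-∷ (∈arcs⇒Adj G e∈) stage add) (s≤s⁻¹ (<-≤-trans (addable-decreases {H} add) F≤))

    round : SparseSubgraph G r k ⊎ Shrinks W
    round = run _ stage-[] ≤-refl

  -- Each unsuccessful round divides the bound on the vertex set by `k` and costs `colorLoss`
  -- colours, so after `j` of them no vertex is left.
  search : ∀ j (W : List V) → Unique W → length W < k ^ j →
           ¬ ColorableOn G W (j * colorLoss + 1) → SparseSubgraph G r k
  -- The extra `+ 1` is used here: a total function needs a colour even when `W` is empty.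
  search zero [] _ _ uncol = contradiction ((λ _ → Fin.zero) , λ ()) uncol
  search zero (_ ∷ _) _ (s≤s ()) _
  search (suc j) W unique W< uncol with round W unique
  ... | inj₁ found = found
  ... | inj₂ shrinks = search j core unique′
    (*-cancelʳ-< k (length core) (k ^ j) (≤-<-trans small (subst (length W <_) (*-comm k (k ^ j)) W<)))
    (λ col → uncol (subst (ColorableOn G W) (sym (+-assoc colorLoss (j * colorLoss) 1)) (extends _ col)))
    where open Shrinks shrinks renaming (unique to unique′)

-- Translation between edge lists and graphs.

Colorable-mono : ∀ G {b c} → b ≤ c → Colorable G b → Colorable G c
Colorable-mono G b≤c (f , proper) = (λ v → Fin.inject≤ (f v) b≤c) ,
  λ u v uv eq → proper u v uv (Fin.inject≤-injective b≤c b≤c _ _ eq)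

-- The listed edges on the full vertex set of `G` form the required subgraph: its cycles are tours,
-- and its chromatic number even exceeds `k`.
sparse⇒≤h : ∀ {r k} G → SparseSubgraph G r k → k ≤ h r G
sparse⇒≤h {r} {k} G sparse = ≤-trans (<⇒≤ χ>k) (proj₂ (h-isGreatest r G) (χ H) (H , H⊆G , large-girth , refl))
  where
  open SparseSubgraph sparse

  arc? : ∀ u v → Dec ((u , v) ∈ darts edgeSet)
  arc? u v = Any.any? (≡-dec Fin._≟_ Fin._≟_ (u , v)) (darts edgeSet)

  arc⇒Adj : ∀ {u v} → (u , v) ∈ darts edgeSet → Adj G u v
  arc⇒Adj uv with ∈darts⇒∈ edgeSet uv
  ... | inj₁ e∈ = inside e∈
  ... | inj₂ e∈ = Graph.symmetric G _ _ (inside e∈)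

  H : Graph
  H = record
    { order = order G
    ; adj = λ u v → isYes (arc? u v)
    ; symmetric = λ u v uv → fromWitness (darts-sym edgeSet (toWitness uv))
    ; irreflexive = λ v vv → Graph.irreflexive G v (arc⇒Adj (toWitness vv))
    }

  H⊆G : H ⊆ G
  H⊆G = id , id , λ u v uv → arc⇒Adj (toWitness uv)

  no-short-cycle : ∀ ℓ → HasCycle H ℓ → r ≤ ℓ
  no-short-cycle (suc ℓ) (s≤s 2≤ℓ , x , injective , steps , closes) = ≮⇒≥ λ ℓ<r →
    noTour 2≤ℓ ℓ<r x (injective , λ i → toWitness (around i))
    where
    around : ∀ i → Adj H (x i) (x (at i 1))
    around i with suc (toℕ i) <? suc ℓ
    ... | yes below = steps i (at i 1) (trans (toℕ-at i 1)
      (trans (cong (_% suc ℓ) (+-comm (toℕ i) 1)) (m<n⇒m%n≡m below)))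
    ... | no ¬below = closes i (at i 1) last (trans (toℕ-at i 1)
      (trans (cong (_% suc ℓ) (trans (+-comm (toℕ i) 1) last)) (n%n≡0 (suc ℓ))))
      where last = ≤-antisym (Fin.toℕ<n i) (≮⇒≥ ¬below)

  large-girth : [ r ] ≤⁺ girth H
  large-girth with girth H | girth-isGirth H
  ... | [ g ] | cycle , _ = [ no-short-cycle g cycle ]
  ... | ⊤⁺    | _         = [ r ] ≤⊤⁺

  χ>k : k < χ H
  χ>k = ≰⇒> λ χ≤k → let f , proper = Colorable-mono H χ≤k (proj₁ (χ-isLeast H)) in
    uncolorable (f , λ {e} e∈ → proper _ _ (fromWitness (∈⇒∈darts edgeSet e∈)))

-- The number of edges does not bound the isolated vertices, whereas the others number at most
-- `length (arcs G)`.
nonIsolated : ∀ G → List (Vertex G)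
nonIsolated G = deduplicate Fin._≟_ (map proj₁ (arcs G))

ColorableOn-nonIsolated : ∀ G {c} → ColorableOn G (nonIsolated G) c → Colorable G c
ColorableOn-nonIsolated G (f , proper) = f , λ u v uv →
  proper (∈nonIsolated uv) (∈nonIsolated (Graph.symmetric G u v uv)) uv
  where
  ∈nonIsolated : ∀ {u v} → Adj G u v → u ∈ nonIsolated G
  ∈nonIsolated uv = ∈-deduplicate⁺ Fin._≟_ (∈-map⁺ proj₁ (Adj⇒∈arcs G uv))

-- Choice of exponents and the case of integer exponents.

-- `k′` is the integer part of the `K`-th root of `n`. Replacing `k` by `k′` bounds the chromatic
-- number above by a power as well.
power-bracket : ∀ K .{{_ : NonZero K}} {k n} → k ^ K ≤ n → ∃[ k′ ] k ≤ k′ × k′ ^ K ≤ n × n < suc k′ ^ K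
power-bracket K {k} {n} k^K≤n = climb n k (m≤m+n n k) k^K≤n
  where
  climb : ∀ fuel k → n ≤ fuel + k → k ^ K ≤ n → ∃[ k′ ] k ≤ k′ × k′ ^ K ≤ n × n < suc k′ ^ K
  climb fuel k n≤ k^K≤n with n <? suc k ^ K
  ... | yes n< = k , ≤-refl , k^K≤n , n<
  climb zero k n≤k k^K≤n | no n≮ = contradiction (≤-<-trans n≤k (m≤m^n k K)) n≮
    where
    m≤m^n : ∀ m K .{{_ : NonZero K}} → suc m ≤ suc m ^ K
    m≤m^n m (suc K) = m≤m*n (suc m) (suc m ^ K) {{m^n≢0 (suc m) K}}
  climb (suc fuel) k n≤ k^K≤n | no n≮
    with k′ , k<k′ , rest ← climb fuel (suc k) (subst (n ≤_) (sym (+-suc fuel k)) n≤) (≮⇒≥ n≮) =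
    k′ , <⇒≤ k<k′ , rest

-- With q = k^c: j rounds suffice for 2 e(G) < k^j vertices, j ≤ m c makes m
-- colourings enough for a refinement, a round loses at most k^(m+b) colours, and
-- j < 2^y ≤ k^y with y + m + b < K keeps the total loss below k^K.  The value of z
-- only serves to make j < 2^(z+z), although j itself is linear in z.
module Exponents (r A : ℕ) where

  c b z y m K j : ℕ
  c = suc (suc (4 * A))
  b = suc ((4 + c) * r)
  z = 2 + 4 * A * suc b + 8 * A
  y = z + z
  m = suc (y + b)
  K = m + m
  j = 2 + K * (2 * A)

  -- As `K = m + m`, `j` is 2 + 4 A m, while `m * c` is 2 m + 4 A m.
  j≤m*c : j ≤ m * c
  j≤m*c = ≤-trans (m≤m+n j (2 * (y + b))) (≤-reflexive (expand (y + b) A))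
    where
    expand : ∀ x A → (2 + (suc x + suc x) * (2 * A)) + 2 * x ≡ suc x * suc (suc (4 * A))
    expand = solve-∀

  -- Both `2 + 4 * A * suc b` and `8 * A` are at most `z`, so `j` is at most z (z + 1).
  j<2^y : j < 2 ^ y
  j<2^y = begin-strict
    j                                     ≡⟨ expand z b A ⟩
    (2 + 4 * A * suc b) + 8 * A * z       ≤⟨ +-mono-≤ (m≤m+n _ (8 * A)) (*-monoˡ-≤ z (m≤n+m (8 * A) (2 + 4 * A * suc b))) ⟩
    suc z * z                             ≤⟨ *-monoˡ-≤ z (m<2^m z) ⟩
    2 ^ z * z                             <⟨ *-monoʳ-< (2 ^ z) {{m^n≢0 2 z}} (m<2^m z) ⟩
    2 ^ z * 2 ^ z                         ≡⟨ ^-distribˡ-+-* 2 z z ⟨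
    2 ^ y                                 ∎
    where
    open ≤-Reasoning
    expand : ∀ z b A → 2 + (suc (z + z + b) + suc (z + z + b)) * (2 * A) ≡ (2 + 4 * A * suc b) + 8 * A * z
    expand = solve-∀

-- The upper bound on `χ G` turns the edge bound into fewer than `k ^ j` arcs; the lower bound
-- exceeds the number of colours that `j` rounds can cost.
large-χ⇒≤h : ∀ r A {k} G → let open Exponents r A in
              2 ≤ k → k ^ K ≤ χ G → χ G < suc k ^ K →
              e G ≤ χ G ^ A → k ≤ h r G
large-χ⇒≤h r A {k} G 2≤k k^K≤χ χ<1+k^K e≤χ^A =
  sparse⇒≤h G (Construction.search G r k p m few-arcs j (nonIsolated G)
    (deduplicate-! Fin._≟_ (map proj₁ (arcs G))) few-vertices uncolorable)
  where
  open Exponents r A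
  open ≤-Reasoning

  instance
    k≢0 : NonZero k
    k≢0 = >-nonZero (≤-trans (s≤s z≤n) 2≤k)

    k^c≢0 : NonZero (k ^ c)
    k^c≢0 = m^n≢0 k c

  p : ℕ
  p = pred (k ^ c)

  1+p≡k^c : suc p ≡ k ^ c
  1+p≡k^c = suc-pred (k ^ c)

  instance
    p≢0 : NonZero p
    p≢0 = >-nonZero (s≤s⁻¹ (begin
      2       ≤⟨ 2≤k ⟩
      k       ≤⟨ m≤m*n k (k ^ suc (4 * A)) {{m^n≢0 k (suc (4 * A))}} ⟩
      k ^ c   ≡⟨ 1+p≡k^c ⟨
      suc p   ∎))

  suc≤k* : ∀ {x} → 1 ≤ x → suc x ≤ k * x
  suc≤k* {x} 1≤x = begin
    1 + x        ≤⟨ +-monoˡ-≤ x 1≤x ⟩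
    x + x        ≡⟨ cong (λ a → x + a) (+-identityʳ x) ⟨
    2 * x        ≤⟨ *-monoˡ-≤ x 2≤k ⟩
    k * x        ∎

  1+k≤k^2 : suc k ≤ k ^ 2
  1+k≤k^2 = ≤-trans (suc≤k* (≤-trans (s≤s z≤n) 2≤k)) (≤-reflexive (cong (k *_) (sym (*-identityʳ k))))

  arcs<k^j : length (arcs G) < k ^ j
  arcs<k^j = begin-strict
    length (arcs G)                ≡⟨ length-darts (edges G) ⟩
    2 * e G                        ≤⟨ *-monoʳ-≤ 2 e≤χ^A ⟩
    -- Bounding k + 1 by k^2 explains the `2 * A` in `j`; the factor 2 and the strict inequality
    -- cost one factor `k` each, whence its `2 +`.
    2 * χ G ^ A                    ≤⟨ *-monoʳ-≤ 2 (^-monoˡ-≤ A (≤-trans (<⇒≤ χ<1+k^K) (^-monoˡ-≤ K 1+k≤k^2))) ⟩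
    2 * ((k ^ 2) ^ K) ^ A          ≡⟨ cong (2 *_) (trans (cong (_^ A) (^-*-assoc k 2 K)) (trans (^-*-assoc k (2 * K) A) (cong (k ^_) (reorder K A)))) ⟩
    2 * k ^ (K * (2 * A))          ≤⟨ *-monoˡ-≤ _ 2≤k ⟩
    k * k ^ (K * (2 * A))          <⟨ suc≤k* (m^n>0 k (suc (K * (2 * A)))) ⟩
    k ^ j                          ∎
    where
    reorder : ∀ K A → 2 * K * A ≡ K * (2 * A)
    reorder = solve-∀

  few-arcs : length (arcs G) < suc p ^ m
  few-arcs = begin-strict
    length (arcs G)    <⟨ arcs<k^j ⟩
    k ^ j              ≤⟨ ^-monoʳ-≤ k j≤m*c ⟩
    k ^ (m * c)        ≡⟨ cong (k ^_) (*-comm m c) ⟩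
    k ^ (c * m)        ≡⟨ ^-*-assoc k c m ⟨
    (k ^ c) ^ m        ≡⟨ cong (_^ m) 1+p≡k^c ⟨
    suc p ^ m          ∎

  few-vertices : length (nonIsolated G) < k ^ j
  few-vertices = begin-strict
    length (nonIsolated G)         ≤⟨ length-deduplicate Fin._≟_ (map proj₁ (arcs G)) ⟩
    length (map proj₁ (arcs G))    ≡⟨ length-map proj₁ (arcs G) ⟩
    length (arcs G)                <⟨ arcs<k^j ⟩
    k ^ j                          ∎

  open Construction G r k p m few-arcs using (maxDegree; colorLoss)

  1+maxDegree≤ : suc maxDegree ≤ k ^ (4 + c)
  1+maxDegree≤ = begin
    suc maxDegree                        ≤⟨ suc≤k* (*-mono-≤ {1} {2} (s≤s z≤n) (*-mono-≤ {1} {suc p} (s≤s z≤n) (*-mono-≤ 1≤k 1≤k))) ⟩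
    k * (2 * (suc p * (k * k)))          ≤⟨ *-monoʳ-≤ k (*-monoˡ-≤ (suc p * (k * k)) 2≤k) ⟩
    k * (k * (suc p * (k * k)))          ≡⟨ cong (λ q → k * (k * (q * (k * k)))) 1+p≡k^c ⟩
    k * (k * (k ^ c * (k * k)))          ≡⟨ reorder k (k ^ c) ⟩
    k ^ (4 + c)                          ∎
    where
    1≤k = ≤-trans (s≤s z≤n) 2≤k
    reorder : ∀ k x → k * (k * (x * (k * k))) ≡ k * (k * (k * (k * x)))
    reorder = solve-∀

  colorLoss≤ : colorLoss ≤ k ^ (m + b)
  colorLoss≤ = begin
    k ^ m * suc (suc maxDegree ^ r)      ≤⟨ *-monoʳ-≤ (k ^ m) (s≤s (^-monoˡ-≤ r 1+maxDegree≤)) ⟩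
    k ^ m * suc ((k ^ (4 + c)) ^ r)      ≡⟨ cong (λ x → k ^ m * suc x) (^-*-assoc k (4 + c) r) ⟩
    k ^ m * suc (k ^ ((4 + c) * r))      ≤⟨ *-monoʳ-≤ (k ^ m) (suc≤k* (m^n>0 k ((4 + c) * r))) ⟩
    k ^ m * k ^ b                        ≡⟨ ^-distribˡ-+-* k m b ⟨
    k ^ (m + b)                          ∎

  colors<k^K : j * colorLoss + 1 < k ^ K
  colors<k^K = begin-strict
    j * colorLoss + 1             ≤⟨ +-monoʳ-≤ (j * colorLoss) (*-mono-≤ (m^n>0 k m) (s≤s z≤n)) ⟩
    j * colorLoss + colorLoss     ≡⟨ +-comm (j * colorLoss) colorLoss ⟩
    suc j * colorLoss             ≤⟨ *-mono-≤ (≤-trans j<2^y (^-monoˡ-≤ y 2≤k)) colorLoss≤ ⟩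
    k ^ y * k ^ (m + b)           ≡⟨ ^-distribˡ-+-* k y (m + b) ⟨
    k ^ (y + (m + b))             <⟨ ^-monoʳ-< k 2≤k (≤-reflexive (reorder y m b)) ⟩
    k ^ K                         ∎
    where
    reorder : ∀ y m b → suc (y + (m + b)) ≡ m + suc (y + b)
    reorder = solve-∀

  uncolorable : ¬ ColorableOn G (nonIsolated G) (j * colorLoss + 1)
  uncolorable col = <⇒≱ (<-≤-trans colors<k^K k^K≤χ)
    (proj₂ (χ-isLeast G) _ (ColorableOn-nonIsolated G col))

-- Real parameters and the threshold bound.

-- Any rational upper bound of `x` is itself below one plus the absolute value of its numerator.
below-natural : (x : ℝ) → ∃[ u ] x <ℚ (+ u) ℚ./ 1
below-natural x with q@(mkℚ n d _) , x<q ← ℝ.upper-inhabited x =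
  suc ∣ n ∣ , ℝ.upper-closed x (subst (q ℚ.<_) (sym u/1) (*<* (bound n))) x<q
  where
  coprime : ∀ u → Coprime.Coprime u 1
  coprime u = Coprime.sym (Coprime.1-coprimeTo u)

  u/1 : (+ suc ∣ n ∣) ℚ./ 1 ≡ mkℚ (+ suc ∣ n ∣) 0 (coprime (suc ∣ n ∣))
  u/1 = ℚ.↥p/↧p≡p (mkℚ (+ suc ∣ n ∣) 0 (coprime (suc ∣ n ∣)))

  bound : ∀ n → n ℤ.* (+ 1) ℤ.< (+ suc ∣ n ∣) ℤ.* (+ suc d)
  bound n = subst (ℤ._< (+ suc ∣ n ∣) ℤ.* (+ suc d)) (sym (ℤ.*-identityʳ n))
    (ℤ.<-≤-trans (below n) (ℤ.+≤+ (m≤m*n (suc ∣ n ∣) (suc d))))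
    where
    below : ∀ n → n ℤ.< + suc ∣ n ∣
    below (+ n) = ℤ.+<+ (n<1+n n)
    below -[1+ n ] = ℤ.-<+

-- Natural numbers `u` above `C` and `a` above `P` reduce sparsity to e(G) ≤ u χ^a, and u < 2^u ≤
-- χ^u absorbs the constant, so the exponent `u + a` serves as `A`.
forces : ∀ r (P C : ℝ) → ∃[ K ] (∀ k → 2 ≤ k → Forces P C k r (k ^ K))
forces r P C with a , P<a ← below-natural P | u , C<u ← below-natural C = K , forces-k
  where
  open Exponents r (u + a)
  open ≤-Reasoning

  forces-k : ∀ k → 2 ≤ k → Forces P C k r (k ^ K)
  forces-k k 2≤k G sparse k^K≤χ with k′ , k≤k′ , k′^K≤χ , χ<1+k′^K ← power-bracket K k^K≤χ =
    ≤-trans k≤k′ (large-χ⇒≤h r (u + a) G (≤-trans 2≤k k≤k′) k′^K≤χ χ<1+k′^K (begin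
      e G                      ≡⟨ trans (*-identityʳ (e G * 1)) (*-identityʳ (e G)) ⟨
      (e G * 1) ^ 1            ≤⟨ sparse u 1 a 1 C<u P<a ⟩
      u ^ 1 * χ G ^ a          ≡⟨ cong (_* χ G ^ a) (*-identityʳ u) ⟩
      u * χ G ^ a              ≤⟨ *-monoˡ-≤ (χ G ^ a) (≤-trans (<⇒≤ (m<2^m u)) (^-monoˡ-≤ u 2≤χ)) ⟩
      χ G ^ u * χ G ^ a        ≡⟨ ^-distribˡ-+-* (χ G) u a ⟨
      χ G ^ (u + a)            ∎))
    where
    2≤χ : 2 ≤ χ G
    2≤χ = ≤-trans 2≤k (≤-trans (m≤m*n k (k ^ (y + b + m)) {{m^n≢0 k (y + b + m) {{>-nonZero (≤-trans (s≤s z≤n) 2≤k)}}}}) k^K≤χ)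

threshold≤ : ∀ r (P C : ℝ) → ∃[ K ] (∀ k → 2 ≤ k → Threshold≤ P C k r (k ^ K))
threshold≤ r P C = let K , forces-K = forces r P C in
  K , λ k 2≤k → Equivalence.from (threshold≤⇔forces P C k r (k ^ K)) (forces-K k 2≤k)

proposition10p47 : ((r : ℕ) → 4 ≤ r → (P C : ℝ) → (+ 2) / 1 ℚ≤ P → (+ 2) / 1 ℚ≤ C →
    ∃[ K ] (∀ (k : ℕ) → 2 ≤ k → Threshold≤ P C k r (k ^ K)))
    ×
    ((P C : ℝ) → (+ 2) / 1 ℚ≤ P → (+ 2) / 1 ℚ≤ C →
    ∃[ K ] (∀ (k : ℕ) → 2 ≤ k → Threshold≤ P C k 5 (k ^ K)))
proposition10p47 = (λ r _ P C _ _ → threshold≤ r P C) , (λ P C _ _ → threshold≤ 5 P C)
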